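{- For every integer $n\ge 3$, the bubble-sort graph $Sym_n(t)$ satisfies $$N(Sym_n(t),1)=2\quad\text{and}\quad N(Sym_n(t),2)=2(n-1).$$
   Context: For an integer $n$, $Sym_n$ is the symmetric group on $\{1,\dots,n\}$. The bubble-sort graph $Sym_n(t)$ is the Cayley graph with vertex set $Sym_n$ and edges $\{g,gs\}$ for $g\in Sym_n$, $s\in t$, where $t=\{t_{i,i+1}: 1\le i<n\}$ is the set of adjacent transpositions ($t_{i,i+1}$ is the transposition interchanging $i$ and $i+1$). For a finite connected simple graph $\Gamma$ with vertex set $V(\Gamma)$ and path distance $d$, let $B_r(x)=\{y\in V(\Gamma): d(x,y)\le r\}$ and $$N(\Gamma,r)=\max_{x,y\in V(\Gamma),\ x\ne y}|B_r(x)\cap B_r(y)|.$$ -}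

module Defs where

open import Algebra.Bundles using (Group)
import Algebra.Properties.Group as GroupProperties
open import Data.Fin.Base using (Fin; toℕ)
open import Data.Fin.Permutation
  using (Permutation′; transpose; _⟨$⟩ʳ_; _⟨$⟩ˡ_; inverseˡ; inverseʳ; flip; _∘ₚ_)
  renaming (id to idₚ; _≈_ to _≈ₚ_)
import Data.Fin.Permutation.Components as PC
open import Data.Fin.Properties using (_≟_)
open import Data.Nat.Base using (ℕ; zero; suc; _≤_)
open import Data.Nat.Properties using (1+n≢n)
open import Data.Product.Base using (∃; ∃₂; _×_; _,_; proj₁)
open import Function.Bundles using (Inverse)
open import Level using (0ℓ; _⊔_)
open import Relation.Binary.Bundles using (Setoid)
open import Relation.Binary.Core using (Rel)
open import Relation.Binary.Definitions using (Symmetric; _Respects_; _Respects₂_)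
import Relation.Binary.Construct.On as On
open import Relation.Binary.PropositionalEquality
  using (_≡_; refl; sym; trans; cong; setoid)
open import Relation.Nullary using (¬_; yes; no; contradiction)
open import Relation.Unary using (Pred; _∈_; _∉_; _∩_)

-- Vertices form a setoid because permutations in the standard library are
-- compared pointwise.
record SimpleGraph : Set₁ where
  field
    vertices    : Setoid 0ℓ 0ℓ
  open Setoid vertices public
    using (_≈_; _≉_) renaming (Carrier to V)
  field
    Adj         : Rel V 0ℓ
    Adj-resp    : Adj Respects₂ _≈_
    Adj-sym     : Symmetric Adj
    Adj-irrefl  : ∀ {x} → ¬ Adj x x

module _ {a ℓ} (S : Setoid a ℓ) where
  open Setoid S using (Carrier)

  -- HasCard P k: the subset P has exactly k elements up to setoid equality;
  -- membership proofs are disregarded when comparing elements.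
  HasCard : ∀ {p} → Pred Carrier p → ℕ → Set (a ⊔ ℓ ⊔ p)
  HasCard P k = Inverse (setoid (Fin k)) (On.setoid S (proj₁ {B = P}))

module _ (Γ : SimpleGraph) where
  open SimpleGraph Γ

  data Walk : V → V → ℕ → Set where
    here : ∀ {x y} → x ≈ y → Walk x y zero
    step : ∀ {x y z k} → Adj x y → Walk y z k → Walk x z (suc k)

  -- d as a relation: no k is related to vertices in different components, so
  -- neither finiteness nor connectedness of Γ is needed to define N.
  IsDistance : V → V → ℕ → Set
  IsDistance x y k = Walk x y k × (∀ {j} → Walk x y j → k ≤ j)

  Ball : ℕ → V → Pred V 0ℓ
  Ball r x y = ∃ λ k → IsDistance x y k × k ≤ r

-- N[ Γ , r ]≡ m: the maximum of |B_r(x) ∩ B_r(y)| over x ≠ y is m.  Besides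
-- m being attained and an upper bound, this asserts that every intersection
-- has a cardinality, so the bound cannot hold vacuously.
N[_,_]≡_ : SimpleGraph → ℕ → ℕ → Set
N[ Γ , r ]≡ m =
    (∃₂ λ x y → x ≉ y × HasCard vertices (B x ∩ B y) m)
  × (∀ x y → x ≉ y → ∃ λ k → HasCard vertices (B x ∩ B y) k × k ≤ m)
  where
  open SimpleGraph Γ
  B = Ball Γ r

module _ (G : Group 0ℓ 0ℓ) (T : Pred (Group.Carrier G) 0ℓ) where
  open Group G
    using (Carrier; _≈_; _∙_; ε; _⁻¹; ∙-congʳ; ∙-congˡ; assoc; identityʳ)
    renaming (inverseʳ to ∙-inverseʳ; setoid to G-setoid; sym to ≈-sym; trans to ≈-trans)
  open GroupProperties G using (identityʳ-unique)

  cayleyGraph : T Respects _≈_ → (∀ {s} → s ∈ T → s ⁻¹ ∈ T) → ε ∉ T → SimpleGraph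
  cayleyGraph T-resp T-inv ε∉T = record
    { vertices   = G-setoid
    ; Adj        = λ g h → ∃ λ s → s ∈ T × h ≈ g ∙ s
    ; Adj-resp   =
        (λ h≈h′ (s , s∈T , h≈gs) → s , s∈T , ≈-trans (≈-sym h≈h′) h≈gs)
      , (λ g≈g′ (s , s∈T , h≈gs) → s , s∈T , ≈-trans h≈gs (∙-congʳ g≈g′))
    ; Adj-sym    = λ {g} {h} (s , s∈T , h≈gs) → s ⁻¹ , T-inv s∈T , ≈-sym
        (≈-trans (∙-congʳ h≈gs)
        (≈-trans (assoc g s (s ⁻¹))
        (≈-trans (∙-congˡ (∙-inverseʳ s)) (identityʳ g))))
    ; Adj-irrefl = λ {g} (s , s∈T , g≈gs) →
        ε∉T (T-resp (identityʳ-unique g s (≈-sym g≈gs)) s∈T)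
    }

-- Acts on Fin n = {0,…,n-1} in place of {1,…,n}.  The product is composition
-- of functions, (g ∙ h)(i) = g(h(i)), whereas π ∘ₚ ρ applies π first.
Sym : ℕ → Group 0ℓ 0ℓ
Sym n = record
  { Carrier = Permutation′ n
  ; _≈_     = _≈ₚ_
  ; _∙_     = λ g h → h ∘ₚ g
  ; ε       = idₚ
  ; _⁻¹     = flip
  ; isGroup = record
    { isMonoid = record
      { isSemigroup = record
        { isMagma = record
          { isEquivalence = record
            { refl  = λ _ → refl
            ; sym   = λ p i → sym (p i)
            ; trans = λ p q i → trans (p i) (q i)
            }
          ; ∙-cong = λ {g} {g′} {h} {h′} p q i →
              trans (cong (g ⟨$⟩ʳ_) (q i)) (p (h′ ⟨$⟩ʳ i))
          }
        ; assoc = λ _ _ _ _ → refl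
        }
      ; identity = (λ _ _ → refl) , (λ _ _ → refl)
      }
    ; inverse = (λ g _ → inverseˡ g) , (λ g _ → inverseʳ g)
    ; ⁻¹-cong = λ {g} {h} p i →
        trans (sym (inverseˡ h))
        (cong (h ⟨$⟩ˡ_) (trans (sym (p (g ⟨$⟩ˡ i))) (inverseʳ g)))
    }
  }

AdjacentTransposition : ∀ n → Pred (Permutation′ n) 0ℓ
AdjacentTransposition n s =
  ∃₂ λ (i j : Fin n) → toℕ j ≡ suc (toℕ i) × s ≈ₚ transpose i j

private
  transpose-comm : ∀ {n} (i j k : Fin n) → PC.transpose j i k ≡ PC.transpose i j k
  transpose-comm i j k with k ≟ i in p | k ≟ j in q
  ... | yes k≡i  | yes k≡j rewrite p = trans (sym k≡i) k≡j
  ... | yes _    | no _    rewrite p = refl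
  ... | no _     | yes _   rewrite q = refl
  ... | no _     | no _    rewrite p | q = refl

  transpose-matchˡ : ∀ {n} (i j : Fin n) → PC.transpose i j i ≡ j
  transpose-matchˡ i j with i ≟ i
  ... | yes _  = refl
  ... | no i≢i = contradiction refl i≢i

bubbleSortGraph : ℕ → SimpleGraph
bubbleSortGraph n =
  cayleyGraph (Sym n) T (λ {s} {s′} → resp {s} {s′}) (λ {s} → inv {s}) ε∉
  where
  module S = Group (Sym n)
  T = AdjacentTransposition n

  resp : T Respects _≈ₚ_
  resp s≈s′ (i , j , j≡1+i , s≈t) =
    i , j , j≡1+i , λ k → trans (sym (s≈s′ k)) (s≈t k)

  inv : ∀ {s} → s ∈ T → flip s ∈ T
  inv {s} (i , j , j≡1+i , s≈t) = i , j , j≡1+i , λ k →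
    trans (S.⁻¹-cong {s} {transpose i j} s≈t k) (transpose-comm i j k)

  ε∉ : idₚ ∉ T
  ε∉ (i , j , j≡1+i , ε≈t) = 1+n≢n
    (trans (sym j≡1+i) (cong toℕ (sym (trans (ε≈t i) (transpose-matchˡ i j)))))

{-# OPTIONS --safe #-}

-- Recording for each pair of values a < b whether a stands before b embeds
-- Sym_n in a hypercube: an edge of the bubble-sort graph flips exactly one
-- coordinate, and vertices differing in one coordinate are adjacent, because a
-- value standing between a and b would violate transitivity after the flip.
-- This and (n-1)-regularity suffice.  With m = n - 1, let x ≠ y.
-- If x and y differ in an odd number of coordinates, any u within distance 2
-- of both is by parity a neighbour of x or of y, whence at most 2m such u, with
-- equality when x and y are adjacent.  If they differ in two coordinates e and
-- f, any such u is one of the corners x+e, x+f of the hypercube or next to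
-- one; whether both, one or none of the corners are vertices of the graph, a
-- count gives at most 2m.  If they differ in four coordinates, u is given by
-- two of the four, whence at most 6 ≤ 2m when m ≥ 3, and for m ≤ 2 there are
-- at most m² ≤ 2m walks of length 2 from x.
module Submission where

open import Defs
open import Algebra.Bundles using (Group)
open import Data.Bool.Base using (Bool; true; false; not; _∧_; _xor_)
open import Data.Bool.Properties
  using (not-involutive; not-¬; ¬-not; ∧-zeroʳ; ∧-identityʳ)
  renaming (_≟_ to _≟ᵇ_)
open import Data.Fin.Base using (Fin; zero; suc; toℕ; inject₁; fromℕ<; _<_)
open import Data.Fin.Permutation
  using (Permutation′; transpose; _⟨$⟩ʳ_; _⟨$⟩ˡ_; inverseˡ; inverseʳ; _∘ₚ_)
  renaming (id to idₚ; _≈_ to _≈ₚ_)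
import Data.Fin.Permutation.Components as PC
open import Data.Fin.Properties
  using ( _≟_; _<?_; all?; any?; injective⇒≤; <-cmp; <-trans; <-asym; <-irrefl
        ; toℕ-injective; toℕ-inject₁; toℕ-fromℕ<; toℕ<n; inject₁-injective)
open import Data.List.Base
  using ( List; []; _∷_; [_]; _++_; length; lookup; map; foldr; filter; deduplicate
        ; tabulate; concatMap; upTo; allFin; cartesianProduct)
open import Data.List.Properties using (foldr-++; length-++; length-map; length-tabulate)
import Data.List.Membership.DecPropositional as DecMembership
open import Data.List.Membership.Propositional using (_∈_; _∉_)
open import Data.List.Membership.Propositional.Properties
  using (∈-∃++; ∈-lookup; ∈-upTo⁺; ∈-tabulate⁺; ∈-tabulate⁻; ∈-allFin; ∈-cartesianProduct⁺)
import Data.List.Membership.Setoid as SetoidMembership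
import Data.List.Membership.Setoid.Properties as SetoidMembershipₚ
open import Data.List.Relation.Binary.Permutation.Propositional as ↭ using (_↭_)
open import Data.List.Relation.Binary.Permutation.Propositional.Properties
  using (shift; ↭-length; ∈-resp-↭)
import Data.List.Relation.Binary.Permutation.Setoid.Properties as ↭ₛ
open import Data.List.Relation.Binary.Subset.Propositional using (_⊆_)
open import Data.List.Relation.Unary.All as All using (All; []; _∷_)
import Data.List.Relation.Unary.All.Properties as Allₚ
open import Data.List.Relation.Unary.AllPairs using ([]; _∷_)
open import Data.List.Relation.Unary.Any as Any using (Any; here; there; index)
import Data.List.Relation.Unary.Any.Properties as Anyₚ
open import Data.List.Relation.Unary.Unique.DecSetoid.Properties using (deduplicate-!)
open import Data.List.Relation.Unary.Unique.Propositional using (Unique)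
open import Data.List.Relation.Unary.Unique.Propositional.Properties
  using (allFin⁺; cartesianProduct⁺)
import Data.List.Relation.Unary.Unique.Setoid as SetoidUnique
import Data.List.Relation.Unary.Unique.Setoid.Properties as SetoidUniqueₚ
open import Data.Nat.Base as ℕ
  using (ℕ; zero; suc; _≤_; z≤n; s≤s; _+_; _*_; _∸_; _^_)
open import Data.Nat.Induction using (<-rec)
import Data.Nat.Properties as ℕ
open import Data.Product.Base using (∃; ∃₂; _×_; _,_; proj₁; proj₂)
open import Data.Product.Properties using (≡-dec; ,-injectiveˡ; ,-injectiveʳ)
open import Data.Sum.Base as Sum using (_⊎_; inj₁; inj₂)
open import Function.Base using (_∘_)
open import Function.Bundles using (Inverse)
open import Level using (0ℓ)
open import Relation.Binary.Bundles using (Setoid; DecSetoid)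
open import Relation.Binary.Core using (REL)
open import Relation.Binary.Definitions
  using (Decidable; DecidableEquality; _Respects_; tri<; tri≈; tri>)
open import Relation.Binary.PropositionalEquality
  using (_≡_; _≢_; _≗_; refl; sym; trans; cong; cong₂; subst; subst₂; setoid)
open import Relation.Nullary using (¬_; Dec; yes; no; does; contradiction)
open import Relation.Nullary.Decidable using (map′; _×-dec_; dec-true; dec-false)
import Relation.Unary as Unary
open Unary using (Pred; _∩_)

-- Cardinalities and balls in locally finite graphs

module _ (S : Setoid 0ℓ 0ℓ) where
  open Setoid S renaming (Carrier to A; refl to ≈-refl; sym to ≈-sym; trans to ≈-trans)
  open SetoidMembership S using () renaming (_∈_ to _∈ₛ_)
  open SetoidUnique S using () renaming (Unique to Uniqueₛ)

  lookup-injective : ∀ {xs} → Uniqueₛ xs → ∀ {i j} → lookup xs i ≈ lookup xs j → i ≡ j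
  lookup-injective (_ ∷ _)    {zero}  {zero}  _  = refl
  lookup-injective (x∉ ∷ _)   {zero}  {suc j} eq = contradiction eq (All.lookup x∉ (∈-lookup j))
  lookup-injective (x∉ ∷ _)   {suc i} {zero}  eq = contradiction (≈-sym eq) (All.lookup x∉ (∈-lookup i))
  lookup-injective (_ ∷ xs!)  {suc i} {suc j} eq = cong suc (lookup-injective xs! eq)

  module _ {P : Pred A 0ℓ} where

    -- The cover supplies the inverse map: a membership proof yields an index, and uniqueness makes
    -- this index independent of the proof.
    hasCard-length : ∀ {xs} → Uniqueₛ xs → All P xs → (∀ {x} → P x → x ∈ₛ xs) →
                     HasCard S P (length xs)
    hasCard-length {xs} xs! pxs P⊆xs = record
      { to        = λ i → lookup xs i , All.lookup pxs (∈-lookup i)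
      ; from      = λ (x , px) → index (P⊆xs px)
      ; to-cong   = λ { refl → ≈-refl }
      ; from-cong = λ {(x , px)} {(y , py)} x≈y → lookup-injective xs!
          (≈-trans (≈-sym (at px)) (≈-trans x≈y (at py)))
      ; inverse   = (λ {(x , px)} → λ { refl → ≈-sym (at px) })
                  , (λ {i} {(x , px)} x≈ → lookup-injective xs! (≈-trans (≈-sym (at px)) x≈))
      }
      where
      at : ∀ {x} (px : P x) → x ≈ lookup xs (index (P⊆xs px))
      at px = Anyₚ.lookup-index (P⊆xs px)

    -- The relation `R` attaches codes to elements, and a code determines its element up to `≈`.
    -- Codes attached to nothing are allowed, so a bound may list points of a hypercube that are not
    -- vertices.
    card≤length : ∀ {b r} {B : Set b} {R : REL A B r} →
                  (∀ {x y v} → R x v → R y v → x ≈ y) →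
                  ∀ {k} → HasCard S P k →
                  (vs : List B) → (∀ {x} → P x → Any (R x) vs) → k ≤ length vs
    card≤length {R = R} R-inj {k} card vs cover = injective⇒≤ {f = f} f-inj
      where
      open Inverse card
      f : Fin k → Fin (length vs)
      f i = index (cover (proj₂ (to i)))
      at : ∀ i → R (proj₁ (to i)) (lookup vs (f i))
      at i = Anyₚ.lookup-index (cover (proj₂ (to i)))
      f-inj : ∀ {i j} → f i ≡ f j → i ≡ j
      f-inj {i} {j} eq = trans (sym (strictlyInverseʳ i)) (trans
        (from-cong (R-inj (at i) (subst (R _ ∘ lookup vs) (sym eq) (at j))))
        (strictlyInverseʳ j))

  module _ (_≈?_ : Decidable _≈_) {P : Pred A 0ℓ} (P? : Unary.Decidable P)
           (P-resp : P Respects _≈_) where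

    hasCard-finite : (xs : List A) → (∀ {x} → P x → x ∈ₛ xs) → ∃ (HasCard S P)
    hasCard-finite xs P⊆xs = _ , hasCard-length
      (deduplicate-! decSetoid (filter P? xs))
      (Allₚ.deduplicate⁺ _≈?_ (Allₚ.all-filter P? xs))
      (λ px → SetoidMembershipₚ.∈-deduplicate⁺ S _≈?_ (λ p q → ≈-trans q (≈-sym p))
                (SetoidMembershipₚ.∈-filter⁺ S P? P-resp (P⊆xs px) px))
      where
      decSetoid : DecSetoid 0ℓ 0ℓ
      decSetoid = record { isDecEquivalence = record { isEquivalence = isEquivalence ; _≟_ = _≈?_ } }

module _ (Γ : SimpleGraph) where
  open SimpleGraph Γ

  module LocallyFinite
    (_≈?_ : Decidable _≈_)
    (m : ℕ) (nb : V → Fin m → V)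
    (Adj-nb : ∀ x i → Adj x (nb x i))
    (Adj⇒nb : ∀ {x y} → Adj x y → ∃ λ i → y ≈ nb x i)
    where

    open Setoid vertices using () renaming (refl to ≈-refl; sym to ≈-sym; trans to ≈-trans)
    open SetoidMembership vertices using () renaming (_∈_ to _∈ᵥ_)

    Walk-respˡ : ∀ {x x′ y k} → x ≈ x′ → Walk Γ x y k → Walk Γ x′ y k
    Walk-respˡ x≈x′ (here x≈y)   = here (≈-trans (≈-sym x≈x′) x≈y)
    Walk-respˡ x≈x′ (step adj w) = step (proj₂ Adj-resp x≈x′ adj) w

    Walk-respʳ : ∀ {x y y′ k} → y ≈ y′ → Walk Γ x y k → Walk Γ x y′ k
    Walk-respʳ y≈y′ (here x≈y)   = here (≈-trans x≈y y≈y′)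
    Walk-respʳ y≈y′ (step adj w) = step adj (Walk-respʳ y≈y′ w)

    first-step : ∀ {x y k} → Walk Γ x y (suc k) → ∃ λ i → Walk Γ (nb x i) y k
    first-step (step adj w) with i , z≈ ← Adj⇒nb adj = i , Walk-respˡ z≈ w

    Walk? : ∀ x y k → Dec (Walk Γ x y k)
    Walk? x y zero    = map′ here (λ { (here x≈y) → x≈y }) (x ≈? y)
    Walk? x y (suc k) = map′ (λ (i , w) → step (Adj-nb x i) w) first-step
                             (any? λ i → Walk? (nb x i) y k)

    reach : ℕ → V → List V
    reach zero    x = [ x ]
    reach (suc k) x = concatMap (reach k) (tabulate (nb x))

    Walk⇒∈reach : ∀ {x y} k → Walk Γ x y k → y ∈ᵥ reach k x
    Walk⇒∈reach zero    (here x≈y) = here (≈-sym x≈y)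
    Walk⇒∈reach (suc k) w with i , w′ ← first-step w =
      Anyₚ.concatMap⁺ (reach k) (Anyₚ.tabulate⁺ i (Walk⇒∈reach k w′))

    -- Minimality of the walk is dropped, which makes membership in a ball decidable by a search
    -- over lengths below `suc r`.
    Near : ℕ → V → V → Set
    Near r x y = ∃ λ k → k ℕ.< suc r × Walk Γ x y k

    Ball⇒Near : ∀ {r x y} → Ball Γ r x y → Near r x y
    Ball⇒Near (k , (w , _) , k≤r) = k , s≤s k≤r , w

    -- Strong induction on the length: if a shorter walk exists, pass to it; otherwise the given
    -- walk is a shortest one.
    distance≤ : ∀ {x y} k → Walk Γ x y k → ∃ λ j → IsDistance Γ x y j × j ≤ k
    distance≤ {x} {y} = <-rec _ λ k rec w → case′ k rec w (ℕ.anyUpTo? (Walk? x y) k)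
      where
      case′ : ∀ k → (∀ {j} → j ℕ.< k → Walk Γ x y j → ∃ λ i → IsDistance Γ x y i × i ≤ j) →
              Walk Γ x y k → Dec (∃ λ j → j ℕ.< k × Walk Γ x y j) →
              ∃ λ i → IsDistance Γ x y i × i ≤ k
      case′ k rec w (yes (j , j<k , w′)) with i , d , i≤j ← rec j<k w′ =
        i , d , ℕ.≤-trans i≤j (ℕ.<⇒≤ j<k)
      case′ k rec w (no ∄) =
        k , (w , λ w′ → ℕ.≮⇒≥ λ j<k → ∄ (_ , j<k , w′)) , ℕ.≤-refl

    Near⇒Ball : ∀ {r x y} → Near r x y → Ball Γ r x y
    Near⇒Ball (k , s≤s k≤r , w) with j , d , j≤k ← distance≤ k w = j , d , ℕ.≤-trans j≤k k≤r

    Ball? : ∀ r x y → Dec (Ball Γ r x y)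
    Ball? r x y = map′ Near⇒Ball Ball⇒Near (ℕ.anyUpTo? (Walk? x y) (suc r))

    Ball-respʳ : ∀ {r x y y′} → y ≈ y′ → Ball Γ r x y → Ball Γ r x y′
    Ball-respʳ y≈y′ (k , (w , min) , k≤r) =
      k , (Walk-respʳ y≈y′ w , λ w′ → min (Walk-respʳ (≈-sym y≈y′) w′)) , k≤r

    -- There are finitely many walks of length at most `r` from `x`, up to `≈`, and their endpoints
    -- include the whole intersection.
    Ball∩-card : ∀ r x y → ∃ (HasCard vertices (Ball Γ r x ∩ Ball Γ r y))
    Ball∩-card r x y = hasCard-finite vertices _≈?_
      (λ u → Ball? r x u ×-dec Ball? r y u)
      (λ u≈v (p , q) → Ball-respʳ u≈v p , Ball-respʳ u≈v q)
      (concatMap (λ k → reach k x) (upTo (suc r)))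
      (λ (p , _) → ∈ball (Ball⇒Near p))
      where
      ∈ball : ∀ {u} → Near r x u → u ∈ᵥ concatMap (λ k → reach k x) (upTo (suc r))
      ∈ball (k , k<1+r , w) = Anyₚ.concatMap⁺ (λ k → reach k x)
        (Any.map (λ { refl → Walk⇒∈reach k w }) (∈-upTo⁺ k<1+r))

-- The hypercube E → Bool

module _ {A : Set} where

  ∈⇒↭ : ∀ {x : A} {xs} → x ∈ xs → ∃ λ ys → xs ↭ x ∷ ys
  ∈⇒↭ x∈xs with ys , zs , refl ← ∈-∃++ x∈xs = ys ++ zs , shift _ ys zs

  Unique-⊆⇒length≤ : ∀ {xs ys : List A} → Unique xs → xs ⊆ ys → length xs ≤ length ys
  Unique-⊆⇒length≤ {xs} {ys} xs! xs⊆ys = injective⇒≤ {f = index ∘ at} λ {i} {j} eq →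
    lookup-injective (setoid A) xs! (trans (Anyₚ.lookup-index (at i))
      (trans (cong (lookup ys) eq) (sym (Anyₚ.lookup-index (at j)))))
    where
    at : ∀ i → lookup xs i ∈ ys
    at i = xs⊆ys (∈-lookup i)

module Cube {E : Set} (_≟_ : DecidableEquality E) where
  open DecMembership _≟_ using (_∈?_)

  infixl 6 _⊕_ _⊕*_

  _⊕_ : (E → Bool) → E → E → Bool
  (v ⊕ e) c = does (e ≟ c) xor v c

  -- The head of the list is flipped last, so `v ⊕* (f ∷ e ∷ [])` unfolds to `v ⊕ e ⊕ f`.
  _⊕*_ : (E → Bool) → List E → E → Bool
  v ⊕* es = foldr (λ e w → w ⊕ e) v es

  ⊕-on : ∀ v e → (v ⊕ e) e ≡ not (v e)
  ⊕-on v e rewrite dec-true (e ≟ e) refl = refl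

  ⊕-off : ∀ v {e c} → e ≢ c → (v ⊕ e) c ≡ v c
  ⊕-off v {e} {c} e≢c rewrite dec-false (e ≟ c) e≢c = refl

  ⊕-cong : ∀ {v w} e → v ≗ w → v ⊕ e ≗ w ⊕ e
  ⊕-cong e v≗w c = cong (does (e ≟ c) xor_) (v≗w c)

  ⊕-comm : ∀ v a b → v ⊕ a ⊕ b ≗ v ⊕ b ⊕ a
  ⊕-comm v a b c with does (a ≟ c) | does (b ≟ c)
  ... | false | _     = refl
  ... | true  | false = refl
  ... | true  | true  = refl

  ⊕-cancel : ∀ v a → v ⊕ a ⊕ a ≗ v
  ⊕-cancel v a c with does (a ≟ c)
  ... | false = refl
  ... | true  = not-involutive (v c)

  ⊕*-cong : ∀ {v w} es → v ≗ w → v ⊕* es ≗ w ⊕* es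
  ⊕*-cong []       v≗w = v≗w
  ⊕*-cong (e ∷ es) v≗w = ⊕-cong e (⊕*-cong es v≗w)

  ⊕*-↭ : ∀ {es fs} v → es ↭ fs → v ⊕* es ≗ v ⊕* fs
  ⊕*-↭ v ↭.refl           c = refl
  ⊕*-↭ v (↭.prep e p)     = ⊕-cong e (⊕*-↭ v p)
  ⊕*-↭ v (↭.swap {ys = fs} e f p) c =
    trans (⊕-cong e (⊕-cong f (⊕*-↭ v p)) c) (⊕-comm (v ⊕* fs) f e c)
  ⊕*-↭ v (↭.trans p q)  c = trans (⊕*-↭ v p c) (⊕*-↭ v q c)

  ⊕*-off : ∀ v {c es} → c ∉ es → (v ⊕* es) c ≡ v c
  ⊕*-off v {es = []}     _   = refl
  ⊕*-off v {es = e ∷ es} c∉  =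
    trans (⊕-off (v ⊕* es) (λ { refl → c∉ (here refl) })) (⊕*-off v {es = es} (c∉ ∘ there))

  ⊕*-on : ∀ v {c es} → Unique es → c ∈ es → (v ⊕* es) c ≡ not (v c)
  ⊕*-on v {c} {_ ∷ es} (e∉ ∷ _) (here refl) =
    trans (⊕-on (v ⊕* es) c) (cong not (⊕*-off v (Allₚ.All¬⇒¬Any e∉)))
  ⊕*-on v {c} {_ ∷ es} (e∉ ∷ es!) (there c∈) =
    trans (⊕-off (v ⊕* es) (All.lookup e∉ c∈)) (⊕*-on v es! c∈)

  -- A coordinate of `es` missing from `fs` would be negated on the left and unchanged on the right.
  ⊕*-⊆ : ∀ v {es fs} → Unique es → v ⊕* es ≗ v ⊕* fs → es ⊆ fs
  ⊕*-⊆ v {es} {fs} es! eq {c} c∈es with c ∈? fs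
  ... | yes c∈fs = c∈fs
  ... | no  c∉fs = contradiction
    (trans (sym (⊕*-on v es! c∈es)) (trans (eq c) (⊕*-off v c∉fs))) (not-¬ refl ∘ sym)

  -- Two flips of the same coordinate cancel, so a repeated entry is removed together with its
  -- earlier occurrence.
  ⊕*-reduce : ∀ es → ∃ λ fs → Unique fs × length fs ≤ length es × (∀ v → v ⊕* es ≗ v ⊕* fs)
  ⊕*-reduce []       = [] , [] , z≤n , λ _ _ → refl
  ⊕*-reduce (e ∷ es) with fs , fs! , len , eq ← ⊕*-reduce es with e ∈? fs
  ... | no e∉fs = e ∷ fs , Allₚ.¬Any⇒All¬ fs e∉fs ∷ fs! , s≤s len , λ v → ⊕-cong e (eq v)
  ... | yes e∈fs with gs , p ← ∈⇒↭ e∈fs with _ ∷ gs! ← ↭ₛ.Unique-resp-↭ (setoid E) (↭.↭⇒↭ₛ p) fs! =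
    gs , gs! , ℕ.≤-trans (ℕ.n≤1+n _) (ℕ.≤-trans (subst (_≤ _) (↭-length p) len) (ℕ.n≤1+n _))
       , λ v c → trans (⊕-cong e (λ c′ → trans (eq v c′) (⊕*-↭ v p c′)) c) (⊕-cancel (v ⊕* gs) e c)

  -- One point for each unordered pair of positions in the list, since two flips commute; four
  -- coordinates give six points.
  pairs : (E → Bool) → List E → List (E → Bool)
  pairs v []       = []
  pairs v (e ∷ es) = map (λ f → v ⊕ e ⊕ f) es ++ pairs v es

  ∈-pairs : ∀ {v e f es} → e ∈ es → f ∈ es → e ≢ f → Any (v ⊕ e ⊕ f ≗_) (pairs v es)
  ∈-pairs (here refl) (here refl) e≢f = contradiction refl e≢f
  ∈-pairs (here refl) (there f∈)  _   = Anyₚ.++⁺ˡ (Anyₚ.map⁺ (Any.map (λ { refl c → refl }) f∈))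
  ∈-pairs {v} {e} {f} (there e∈)  (here refl) _   =
    Anyₚ.++⁺ˡ (Anyₚ.map⁺ (Any.map (λ { refl → ⊕-comm v e f }) e∈))
  ∈-pairs {v} {es = g ∷ es} (there e∈) (there f∈) e≢f =
    Anyₚ.++⁺ʳ (map (λ f → v ⊕ g ⊕ f) es) (∈-pairs e∈ f∈ e≢f)

  -- Over a duplicate-free list of all coordinates this is the bipartition of the hypercube: every
  -- flip reverses it.
  parity : List E → (E → Bool) → Bool
  parity cs v = foldr (λ c b → v c xor b) false cs

  parity-cong : ∀ cs {v w} → v ≗ w → parity cs v ≡ parity cs w
  parity-cong []       v≗w = refl
  parity-cong (c ∷ cs) v≗w = cong₂ _xor_ (v≗w c) (parity-cong cs v≗w)

  parity-∉ : ∀ {cs e} v → e ∉ cs → parity cs (v ⊕ e) ≡ parity cs v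
  parity-∉ {[]}     v e∉ = refl
  parity-∉ {c ∷ cs} v e∉ = cong₂ _xor_ (⊕-off v (e∉ ∘ here)) (parity-∉ v (e∉ ∘ there))

  parity-⊕ : ∀ {cs e} v → Unique cs → e ∈ cs → parity cs (v ⊕ e) ≡ not (parity cs v)
  parity-⊕ {e ∷ cs} v (e∉ ∷ _)   (here refl) =
    trans (cong₂ _xor_ (⊕-on v e) (parity-∉ v (Allₚ.All¬⇒¬Any e∉))) (not-xor (v e) _)
    where
    not-xor : ∀ a b → not a xor b ≡ not (a xor b)
    not-xor true  b = sym (not-involutive b)
    not-xor false b = refl
  parity-⊕ {c ∷ cs} v (c∉ ∷ cs!) (there e∈)  =
    trans (cong₂ _xor_ (⊕-off v (All.lookup c∉ e∈ ∘ sym)) (parity-⊕ v cs! e∈)) (xor-not (v c) _)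
    where
    xor-not : ∀ a b → a xor not b ≡ not (a xor b)
    xor-not true  b = refl
    xor-not false b = refl

  ⊕*-comm : ∀ v e es → v ⊕ e ⊕* es ≗ v ⊕* (e ∷ es)
  ⊕*-comm v e []       c = refl
  ⊕*-comm v e (f ∷ es) c = trans (⊕-cong f (⊕*-comm v e es) c) (⊕-comm (v ⊕* es) e f c)

  -- Flips commute and are involutions, so they can be moved to the other side one at a time.
  ⊕*-solve : ∀ {v w} es → w ≗ v ⊕* es → v ≗ w ⊕* es
  ⊕*-solve         []       eq c = sym (eq c)
  ⊕*-solve {v} {w} (e ∷ es) eq c = trans (⊕*-solve es shifted c) (⊕*-comm w e es c)
    where
    shifted : w ⊕ e ≗ v ⊕* es
    shifted c = trans (⊕-cong e eq c) (⊕-cancel (v ⊕* es) e c)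

  -- A duplicate-free `es` lists exactly the coordinates in which the two ends differ, and each of
  -- these must occur in `fs`.
  length-minimal : ∀ v {es fs} → Unique es → v ⊕* es ≗ v ⊕* fs → length es ≤ length fs
  length-minimal v {fs = fs} es! eq = Unique-⊆⇒length≤ es! (⊕*-⊆ v {fs = fs} es! eq)

-- Regular induced subgraphs of a hypercube

module _ (Γ : SimpleGraph) {E : Set} (_≟_ : DecidableEquality E) where
  open SimpleGraph Γ
  open Cube _≟_

  -- `I` embeds the vertices in the hypercube. By `I-nb` and `Adj⇒nb` every edge flips one
  -- coordinate, and `I-adj` is the converse that makes the subgraph induced; `lab-injective` makes
  -- it `m`-regular.
  module InducedCube
    (_≈?_ : Decidable _≈_)
    (cs : List E) (cs! : Unique cs) (∈cs : ∀ e → e ∈ cs)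
    (I : V → E → Bool)
    (I-cong : ∀ {x y} → x ≈ y → I x ≗ I y)
    (I-injective : ∀ {x y} → I x ≗ I y → x ≈ y)
    (I-adj : ∀ {x y e} → I y ≗ I x ⊕ e → Adj x y)
    (m : ℕ) (nb : V → Fin m → V) (lab : V → Fin m → E)
    (lab-injective : ∀ x {i j} → lab x i ≡ lab x j → i ≡ j)
    (I-nb : ∀ x i → I (nb x i) ≗ I x ⊕ lab x i)
    (Adj⇒nb : ∀ {x y} → Adj x y → ∃ λ i → y ≈ nb x i)
    where

    open LocallyFinite Γ _≈?_ m nb (λ x i → I-adj (I-nb x i)) Adj⇒nb
    open DecMembership _≟_ using (_∈?_)
    open SetoidMembership vertices using () renaming (_∈_ to _∈ᵥ_)
    open Setoid vertices using () renaming (refl to ≈-refl; sym to ≈-sym; trans to ≈-trans)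

    private
      infixr 4 _⨾_
      _⨾_ : ∀ {u v w : E → Bool} → u ≗ v → v ≗ w → u ≗ w
      (p ⨾ q) c = trans (p c) (q c)

      ≗-sym : ∀ {u v : E → Bool} → u ≗ v → v ≗ u
      ≗-sym p c = sym (p c)

      clash : ∀ {A : Set} {a b : Bool} → a ≡ b → a ≡ not b → A
      clash p q = contradiction q (not-¬ p)

      card≤codes : ∀ {P : Pred V 0ℓ} {k} → HasCard vertices P k →
                   ∀ vs → (∀ {u} → P u → Any (I u ≗_) vs) → k ≤ length vs
      card≤codes = card≤length vertices {R = λ u v → I u ≗ v} λ p q → I-injective (p ⨾ ≗-sym q)

      card≤vertices : ∀ {P : Pred V 0ℓ} {k} → HasCard vertices P k →
                      ∀ us → (∀ {u} → P u → u ∈ᵥ us) → k ≤ length us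
      card≤vertices = card≤length vertices {R = _≈_} λ p q → ≈-trans p (≈-sym q)

    -- Labels, parity and short walks

    labels : V → List E
    labels x = tabulate (lab x)

    Adj⇒label : ∀ {x y} → Adj x y → ∃ λ e → e ∈ labels x × I y ≗ I x ⊕ e
    Adj⇒label {x} adj with i , y≈ ← Adj⇒nb adj =
      lab x i , ∈-tabulate⁺ i , (I-cong y≈ ⨾ I-nb x i)

    -- As the subgraph is induced, `x` and `y` are adjacent, and the label of that edge can only be
    -- `e`. Hence a coordinate outside `labels x` leads from `x` to no vertex.
    flip∈labels : ∀ {x y e} → I y ≗ I x ⊕ e → e ∈ labels x
    flip∈labels {x} {e = e} y≗ with f , f∈ , y≗′ ← Adj⇒label (I-adj y≗)
      with here refl ← ⊕*-⊆ (I x) {es = e ∷ []} {fs = f ∷ []} ([] ∷ []) (≗-sym y≗ ⨾ y≗′) (here refl) = f∈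

    label⇒nb : ∀ {x e} → e ∈ labels x → ∃ λ z → I z ≗ I x ⊕ e
    label⇒nb {x} e∈ with i , refl ← ∈-tabulate⁻ e∈ = nb x i , I-nb x i

    σ : V → Bool
    σ x = parity cs (I x)

    σ-cong : ∀ {x y} → I x ≗ I y → σ x ≡ σ y
    σ-cong = parity-cong cs

    parity-flip : ∀ v e → parity cs (v ⊕ e) ≡ not (parity cs v)
    parity-flip v e = parity-⊕ v cs! (∈cs e)

    σ-flip : ∀ {x y e} → I y ≗ I x ⊕ e → σ y ≡ not (σ x)
    σ-flip {x} {e = e} y≗ = trans (parity-cong cs y≗) (parity-flip (I x) e)

    σ-flip₂ : ∀ {x y e f} → I y ≗ I x ⊕ e ⊕ f → σ y ≡ σ x
    σ-flip₂ {x} {e = e} {f} y≗ = trans (parity-cong cs y≗) (trans (parity-flip (I x ⊕ e) f)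
      (trans (cong not (parity-flip (I x) e)) (not-involutive (σ x))))

    data Odd (x u : V) : Set where
      one : ∀ e → e ∈ labels x → I u ≗ I x ⊕ e → Odd x u

    -- `two` keeps the walk for counting walks, and the middle vertex `w` to show that `p` is a
    -- label at `x`. It also covers `p ≡ q`, a return to `x`.
    data Even (x u : V) : Set where
      none : I u ≗ I x → Even x u
      two  : ∀ p q {w} → Walk Γ x u 2 → I w ≗ I x ⊕ p → I u ≗ I w ⊕ q → Even x u

    σ-odd : ∀ {x u} → Odd x u → σ u ≡ not (σ x)
    σ-odd (one e _ u≗) = σ-flip u≗

    σ-even : ∀ {x u} → Even x u → σ u ≡ σ x
    σ-even (none u≗)           = σ-cong u≗
    σ-even (two p q _ w≗ u≗) = σ-flip₂ (u≗ ⨾ ⊕-cong q w≗)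

    view : ∀ {x u} → Ball Γ 2 x u → Even x u ⊎ Odd x u
    view b with Ball⇒Near b
    ... | _ , _ , here x≈u = inj₁ (none (I-cong (≈-sym x≈u)))
    ... | _ , _ , step a (here w≈u) with e , e∈ , w≗ ← Adj⇒label a =
      inj₂ (one e e∈ (I-cong (≈-sym w≈u) ⨾ w≗))
    ... | _ , _ , walk@(step a (step b (here w≈u)))
      with p , _ , w≗ ← Adj⇒label a | q , _ , v≗ ← Adj⇒label b =
      inj₁ (two p q walk w≗ (I-cong (≈-sym w≈u) ⨾ v≗))
    ... | _ , s≤s (s≤s (s≤s ())) , step _ (step _ (step _ _))

    view₁ : ∀ {x u} → Ball Γ 1 x u → I u ≗ I x ⊎ Odd x u
    view₁ b with Ball⇒Near b
    ... | _ , _ , here x≈u = inj₁ (I-cong (≈-sym x≈u))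
    ... | _ , _ , step a (here w≈u) with e , e∈ , w≗ ← Adj⇒label a =
      inj₂ (one e e∈ (I-cong (≈-sym w≈u) ⨾ w≗))
    ... | _ , s≤s (s≤s ()) , step _ (step _ _)

    -- Vertices of opposite parity

    module _ {x y} (σ≢ : σ y ≡ not (σ x)) where

      neighbours : List V
      neighbours = tabulate (nb x) ++ tabulate (nb y)

      length-neighbours : length neighbours ≡ m + m
      length-neighbours = trans (length-++ (tabulate (nb x)))
        (cong₂ _+_ (length-tabulate (nb x)) (length-tabulate (nb y)))

      Odd⇒∈ : ∀ {z u} → Odd z u → u ∈ᵥ tabulate (nb z)
      Odd⇒∈ (one _ _ u≗) with i , u≈ ← Adj⇒nb (I-adj u≗) = Anyₚ.tabulate⁺ i u≈

      odd-cover₁ : ∀ {u} → (Ball Γ 1 x ∩ Ball Γ 1 y) u → u ∈ᵥ x ∷ y ∷ []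
      odd-cover₁ (p , q) with view₁ p | view₁ q
      ... | inj₁ u≗x | _        = here (I-injective u≗x)
      ... | inj₂ _   | inj₁ u≗y = there (here (I-injective u≗y))
      ... | inj₂ r   | inj₂ s   = clash (trans (σ-odd r) (sym σ≢)) (σ-odd s)

      -- If `u` is not a neighbour of `x`, it has the parity of `x`; it cannot also have that of
      -- `y`, so it is a neighbour of `y`.
      odd-cover₂ : ∀ {u} → (Ball Γ 2 x ∩ Ball Γ 2 y) u → u ∈ᵥ neighbours
      odd-cover₂ (p , q) with view p | view q
      ... | inj₂ r | _      = Anyₚ.++⁺ˡ (Odd⇒∈ r)
      ... | inj₁ _ | inj₂ s = Anyₚ.++⁺ʳ (tabulate (nb x)) (Odd⇒∈ s)
      ... | inj₁ r | inj₁ s = clash (σ-even r) (trans (σ-even s) σ≢)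

    module _ {x y} (adj : Adj x y) where

      private
        σ≢ : σ y ≡ not (σ x)
        σ≢ with e , _ , y≗ ← Adj⇒label adj = σ-flip y≗

        nb-injective : ∀ z {i j} → nb z i ≈ nb z j → i ≡ j
        nb-injective z {i} {j} eq
          with here l≡ ← ⊕*-⊆ (I z) {es = lab z i ∷ []} {fs = lab z j ∷ []} ([] ∷ [])
                           (≗-sym (I-nb z i) ⨾ I-cong eq ⨾ I-nb z j) (here refl) =
          lab-injective z l≡

        Near⁰ : ∀ {r z} → Near r z z
        Near⁰ = 0 , s≤s z≤n , here ≈-refl

        Near¹ : ∀ {r z w} → Adj z w → Near (suc r) z w
        Near¹ a = 1 , s≤s (s≤s z≤n) , step a (here ≈-refl)

        Near² : ∀ {z w v} → Adj z w → Adj w v → Near 2 z v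
        Near² a b = 2 , ℕ.≤-refl , step a (step b (here ≈-refl))

      adjacent⇒≉ : x ≉ y
      adjacent⇒≉ x≈y = clash (σ-cong (I-cong (≈-sym x≈y))) σ≢

      adjacent-card₁ : HasCard vertices (Ball Γ 1 x ∩ Ball Γ 1 y) 2
      adjacent-card₁ = hasCard-length vertices ((adjacent⇒≉ ∷ []) ∷ [] ∷ [])
        ((Near⇒Ball Near⁰ , Near⇒Ball (Near¹ (Adj-sym adj))) ∷
         (Near⇒Ball (Near¹ adj) , Near⇒Ball Near⁰) ∷ [])
        (odd-cover₁ σ≢)

      -- A neighbour of one end is within two of the other end through the edge between them. The
      -- two neighbourhoods are disjoint because their parities differ.
      adjacent-card₂ : HasCard vertices (Ball Γ 2 x ∩ Ball Γ 2 y) (m + m)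
      adjacent-card₂ = subst (HasCard vertices _) (length-neighbours σ≢)
        (hasCard-length vertices
          (SetoidUniqueₚ.++⁺ vertices
            (SetoidUniqueₚ.tabulate⁺ vertices (nb-injective x))
            (SetoidUniqueₚ.tabulate⁺ vertices (nb-injective y))
            disjoint)
          (Allₚ.++⁺
            (Allₚ.tabulate⁺ λ i → Near⇒Ball (Near¹ (nbx i)) , Near⇒Ball (Near² (Adj-sym adj) (nbx i)))
            (Allₚ.tabulate⁺ λ i → Near⇒Ball (Near² adj (nby i)) , Near⇒Ball (Near¹ (nby i))))
          (odd-cover₂ σ≢))
        where
        nbx : ∀ i → Adj x (nb x i)
        nbx i = I-adj (I-nb x i)
        nby : ∀ i → Adj y (nb y i)
        nby i = I-adj (I-nb y i)
        σ-nb : ∀ {z u} → u ∈ᵥ tabulate (nb z) → σ u ≡ not (σ z)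
        σ-nb {z} u∈ with i , u≈ ← Anyₚ.tabulate⁻ u∈ = σ-flip (I-cong u≈ ⨾ I-nb z i)
        disjoint : ∀ {u} → ¬ (u ∈ᵥ tabulate (nb x) × u ∈ᵥ tabulate (nb y))
        disjoint (p , q) = clash (trans (σ-nb p) (sym σ≢)) (σ-nb q)

    -- Vertices differing in two coordinates

    -- If I y is I x with the coordinates e and f flipped, every even u in both
    -- balls is, up to the choice of e or f, next to the corner I x ⊕ e of the
    -- hypercube, which need not be a vertex of Γ.
    data Side (x : V) (e : E) (u : V) : Set where
      middle : e ∈ labels x → I u ≗ I x ⊕ e → Side x e u
      first  : ∀ q → e ∈ labels x → I u ≗ I x ⊕ e ⊕ q → Side x e u
      second : ∀ p → p ∈ labels x → I u ≗ I x ⊕ p ⊕ e → Side x e u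

    private
      -- Both `e` and `f` must occur among `p` and `q`; being distinct, they cannot both be `q`.
      pair-cases : ∀ v {p q e f} → e ≢ f → v ⊕ p ⊕ q ≗ v ⊕ e ⊕ f → p ≡ e ⊎ p ≡ f
      pair-cases v {p} {q} {e} {f} e≢f eq
        with ⊕*-⊆ v {es = f ∷ e ∷ []} {fs = q ∷ p ∷ []} ((e≢f ∘ sym ∷ []) ∷ [] ∷ []) (≗-sym eq)
      ... | ⊆ with ⊆ (here refl) | ⊆ (there (here refl))
      ... | there (here f≡p) | _                = inj₂ (sym f≡p)
      ... | here _           | there (here e≡p) = inj₁ (sym e≡p)
      ... | here f≡q         | here e≡q         = contradiction (trans e≡q (sym f≡q)) e≢f

    module _ {x y e f} (e≢f : e ≢ f) (y≗ : I y ≗ I x ⊕ e ⊕ f) where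

      private
        both-ends : ∀ {z} → I z ≗ I x → I z ≗ I y → ∀ {A : Set} → A
        both-ends z≗x z≗y = contradiction
          (length-minimal (I x) {es = f ∷ e ∷ []} {fs = []} ((e≢f ∘ sym ∷ []) ∷ [] ∷ [])
            (≗-sym y≗ ⨾ ≗-sym z≗y ⨾ z≗x)) λ ()

        σ≡ : σ y ≡ σ x
        σ≡ = σ-flip₂ y≗

        x≗ : I x ≗ I y ⊕ e ⊕ f
        x≗ = ⊕*-solve (f ∷ e ∷ []) y≗

        -- Flipping `p` and then `q` leads from `x` through `u` to `y`, so these are the flips `e`
        -- and `f` in some order.
        via : ∀ {u p q} → I u ≗ I x ⊕ p → I u ≗ I y ⊕ q → p ≡ e ⊎ p ≡ f
        via {q = q} u≗ u≗′ = pair-cases (I x) e≢f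
          (≗-sym (⊕*-solve (q ∷ []) u≗′ ⨾ ⊕-cong q u≗) ⨾ y≗)

      even-cover₁ : ∀ {u} → (Ball Γ 1 x ∩ Ball Γ 1 y) u → Any (I u ≗_) ((I x ⊕ e) ∷ (I x ⊕ f) ∷ [])
      even-cover₁ (b , b′) with view₁ b | view₁ b′
      ... | inj₁ u≗x | inj₁ u≗y = both-ends u≗x u≗y
      ... | inj₁ u≗x | inj₂ o   = clash (trans (σ-cong u≗x) (sym σ≡)) (σ-odd o)
      ... | inj₂ o   | inj₁ u≗y = clash (trans (σ-cong u≗y) σ≡) (σ-odd o)
      ... | inj₂ (one p _ u≗) | inj₂ (one q _ u≗′) with via {p = p} {q} u≗ u≗′
      ... | inj₁ refl = here u≗
      ... | inj₂ refl = there (here u≗)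

      -- If `u` is one flip from both ends, it is a corner. Otherwise `e` and `f` occur among the
      -- flips from `x` to `u` and from `y` to `u`; if neither is among the former, the latter lead
      -- from `y` back to `x`, so `u` is `x`, which is treated separately.
      even-cover₂ : ∀ {u} → (Ball Γ 2 x ∩ Ball Γ 2 y) u → Side x e u ⊎ Side x f u
      even-cover₂ {u} (b , b′) with view b | view b′
      ... | inj₁ ev | inj₂ o = clash (trans (σ-even ev) (sym σ≡)) (σ-odd o)
      ... | inj₂ o | inj₁ ev = clash (trans (σ-even ev) σ≡) (σ-odd o)
      ... | inj₂ (one p p∈ u≗) | inj₂ (one q _ u≗′) with via {p = p} {q} u≗ u≗′
      ... | inj₁ refl = inj₁ (middle p∈ u≗)
      ... | inj₂ refl = inj₂ (middle p∈ u≗)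
      even-cover₂ {u} (b , b′) | inj₁ ev | inj₁ ev′ with u ≈? x
      even-cover₂ {u} (b , b′) | inj₁ ev | inj₁ ev′ | yes u≈x with ev′
      ... | none u≗y = both-ends (I-cong u≈x) u≗y
      -- Here `u` is `x`. The walk from `y` enters `x` through a corner `w`, so `x` counts as next
      -- to that corner: its coordinate `s` is flipped twice.
      ... | two r s {w} _ w≗y u≗w
        with w≗x ← ⊕*-solve {I w} {I x} (s ∷ []) (≗-sym (I-cong u≈x) ⨾ u≗w)
           | u≗ ← I-cong u≈x ⨾ ≗-sym (⊕-cancel (I x) s)
        with via {w} {s} {r} w≗x w≗y
      ... | inj₁ refl = inj₁ (first s (flip∈labels w≗x) u≗)
      ... | inj₂ refl = inj₂ (first s (flip∈labels w≗x) u≗)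
      even-cover₂ {u} (b , b′) | inj₁ (none u≗x) | inj₁ ev′ | no u≉x = contradiction (I-injective u≗x) u≉x
      even-cover₂ {u} (b , b′) | inj₁ (two p q _ w≗ u≗) | inj₁ (none u≗y) | no u≉x
        with pair-cases (I x) e≢f (≗-sym (u≗ ⨾ ⊕-cong q w≗) ⨾ u≗y ⨾ y≗)
      ... | inj₁ refl = inj₁ (first q (flip∈labels w≗) (u≗ ⨾ ⊕-cong q w≗))
      ... | inj₂ refl = inj₂ (first q (flip∈labels w≗) (u≗ ⨾ ⊕-cong q w≗))
      even-cover₂ {u} (b , b′) | inj₁ (two p q {w} _ w≗ u≗) | inj₁ (two r s {w′} _ w′≗ u≗′) | no u≉x =
        cases (⊆ (there (here refl))) (⊆ (here refl))
        where
        u≗₂ : I u ≗ I x ⊕ p ⊕ q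
        u≗₂ = u≗ ⨾ ⊕-cong q w≗
        u≗₂′ : I u ≗ I y ⊕ r ⊕ s
        u≗₂′ = u≗′ ⨾ ⊕-cong s w′≗
        ⊆ : ∀ {c} → c ∈ f ∷ e ∷ [] → c ∈ s ∷ r ∷ q ∷ p ∷ []
        ⊆ = ⊕*-⊆ (I x) ((e≢f ∘ sym ∷ []) ∷ [] ∷ [])
          (≗-sym y≗ ⨾ ⊕*-solve (s ∷ r ∷ []) u≗₂′ ⨾ ⊕-cong s (⊕-cong r u≗₂))
        cases : e ∈ s ∷ r ∷ q ∷ p ∷ [] → f ∈ s ∷ r ∷ q ∷ p ∷ [] → Side x e u ⊎ Side x f u
        cases (there (there (here refl)))         _ = inj₁ (second p (flip∈labels w≗) u≗₂)
        cases (there (there (there (here refl)))) _ = inj₁ (first q (flip∈labels w≗) u≗₂)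
        cases _ (there (there (here refl)))         = inj₂ (second p (flip∈labels w≗) u≗₂)
        cases _ (there (there (there (here refl)))) = inj₂ (first q (flip∈labels w≗) u≗₂)
        cases (here refl)         (here f≡s)          = contradiction (sym f≡s) e≢f
        cases (there (here refl)) (there (here f≡r))  = contradiction (sym f≡r) e≢f
        -- In this clause and the next, `r` and `s` are `e` and `f` in some order, which forces `u`
        -- to be `x`.
        cases (here refl)         (there (here refl)) =
          contradiction (I-injective (u≗₂′ ⨾ ⊕-comm (I y) f e ⨾ ≗-sym x≗)) u≉x
        cases (there (here refl)) (here refl)         =
          contradiction (I-injective (u≗₂′ ⨾ ≗-sym x≗)) u≉x

    closedNb : V → List (E → Bool)
    closedNb z = I z ∷ map (I z ⊕_) (labels z)

    length-map-labels : ∀ {z} (h : E → E → Bool) → length (map h (labels z)) ≡ m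
    length-map-labels {z} h = trans (length-map h (labels z)) (length-tabulate (lab z))

    private
      ∈-map-≗ : ∀ {u : E → Bool} {h : E → E → Bool} {e es} → e ∈ es → u ≗ h e → Any (u ≗_) (map h es)
      ∈-map-≗ e∈ u≗ = Anyₚ.map⁺ (Any.map (λ { refl → u≗ }) e∈)

    -- Once the corner is a vertex `z`, both routes through `e` end one flip away from `z`, because
    -- flips commute; being induced, the subgraph has that flip as a label at `z`.
    Side-labelled : ∀ {x e z u} → I z ≗ I x ⊕ e → Side x e u →
                    I u ≗ I z ⊎ ∃ λ g → g ∈ labels z × I u ≗ I z ⊕ g
    Side-labelled {x} {e} {z} z≗ (middle _ u≗) = inj₁ (u≗ ⨾ ≗-sym z≗)
    Side-labelled {x} {e} {z} z≗ (first q _ u≗) = inj₂ (q , flip∈labels u≗z , u≗z)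
      where u≗z = u≗ ⨾ ⊕-cong q (≗-sym z≗)
    Side-labelled {x} {e} {z} z≗ (second p _ u≗) = inj₂ (p , flip∈labels u≗z , u≗z)
      where u≗z = u≗ ⨾ ⊕-comm (I x) p e ⨾ ⊕-cong p (≗-sym z≗)

    Side-closedNb : ∀ {x e z u} → I z ≗ I x ⊕ e → Side x e u → Any (I u ≗_) (closedNb z)
    Side-closedNb z≗ side with Side-labelled z≗ side
    ... | inj₁ u≗z            = here u≗z
    ... | inj₂ (g , g∈ , u≗) = there (∈-map-≗ g∈ u≗)

    -- If the corner is not a vertex, no walk passes through it, and only the routes that flip `e`
    -- second remain, one for each label at `x`.
    Side-unlabelled : ∀ {x e u} → e ∉ labels x → Side x e u →
                      ∃ λ p → p ∈ labels x × I u ≗ I x ⊕ p ⊕ e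
    Side-unlabelled e∉ (middle e∈ _)    = contradiction e∈ e∉
    Side-unlabelled e∉ (first _ e∈ _)   = contradiction e∈ e∉
    Side-unlabelled e∉ (second p p∈ u≗) = p , p∈ , u≗

    SideCover : V → E → E → Set
    SideCover x e f = ∃ λ vs → length vs ≤ m + m × (∀ {u} → Side x e u ⊎ Side x f u → Any (I u ≗_) vs)

    SideCover-swap : ∀ {x e f} → SideCover x e f → SideCover x f e
    SideCover-swap (vs , len , cover) = vs , len , cover ∘ Sum.swap

    labels-split : ∀ {z g} → g ∈ labels z → ∃ λ gs → labels z ↭ g ∷ gs × suc (length gs) ≡ m
    labels-split {z} g∈ with gs , p ← ∈⇒↭ g∈ =
      gs , p , trans (sym (↭-length p)) (length-tabulate (lab z))

    module _ {x y e f} (e≢f : e ≢ f) (y≗ : I y ≗ I x ⊕ e ⊕ f) where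

      -- x and y neighbour both corners, so they are listed only once.
      both-labelled : e ∈ labels x → f ∈ labels x → SideCover x e f
      both-labelled e∈ f∈
        with z₁ , z₁≗ ← label⇒nb e∈ | z₂ , z₂≗ ← label⇒nb f∈
        with e∈z₂ ← flip∈labels {z₂} {y} {e} (y≗ ⨾ ⊕-comm (I x) e f ⨾ ⊕-cong e (≗-sym z₂≗))
           | f∈z₂ ← flip∈labels {z₂} {x} {f} (⊕*-solve (f ∷ []) z₂≗)
           | f∈z₁ ← flip∈labels {z₁} {y} {f} (y≗ ⨾ ⊕-cong f (≗-sym z₁≗))
           | e∈z₁ ← flip∈labels {z₁} {x} {e} (⊕*-solve (e ∷ []) z₁≗)
        with gs , p , len ← labels-split e∈z₂
        with ∈-resp-↭ p f∈z₂
      ... | here f≡e = contradiction (sym f≡e) e≢f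
      ... | there f∈gs with hs , q ← ∈⇒↭ f∈gs =
        closedNb z₁ ++ I z₂ ∷ map (I z₂ ⊕_) hs , ℕ.≤-reflexive length≡ ,
        λ { (inj₁ s) → Anyₚ.++⁺ˡ (Side-closedNb z₁≗ s)
          ; (inj₂ s) → side₂ (Side-labelled z₂≗ s) }
        where
        length≡ : length (closedNb z₁ ++ I z₂ ∷ map (I z₂ ⊕_) hs) ≡ m + m
        -- The count is `(m + 1) + (1 + (m - 2))`, as `hs` is `labels z₂` without `e` and `f`.
        length≡ = trans (length-++ (closedNb z₁)) (trans
          (cong₂ _+_ (cong suc (length-map-labels (I z₁ ⊕_))) (cong suc (length-map _ hs)))
          (trans (sym (ℕ.+-suc m _)) (cong (m +_) (trans (cong suc (sym (↭-length q))) len))))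
        side₂ : ∀ {u} → I u ≗ I z₂ ⊎ (∃ λ g → g ∈ labels z₂ × I u ≗ I z₂ ⊕ g) →
                Any (I u ≗_) (closedNb z₁ ++ I z₂ ∷ map (I z₂ ⊕_) hs)
        side₂ (inj₁ u≗) = Anyₚ.++⁺ʳ (closedNb z₁) (here u≗)
        side₂ (inj₂ (g , g∈ , u≗)) with ∈-resp-↭ p g∈
        -- Flipping `e` at `z₂` gives `y`, already listed as the flip of `f` at `z₁`; the next case
        -- flips `f` at `z₂` and gives `x`.
        ... | here refl = Anyₚ.++⁺ˡ (there (∈-map-≗ f∈z₁
          (u≗ ⨾ ⊕-cong e z₂≗ ⨾ ⊕-comm (I x) f e ⨾ ⊕-cong f (≗-sym z₁≗))))
        ... | there g∈gs with ∈-resp-↭ q g∈gs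
        ... | here refl = Anyₚ.++⁺ˡ (there (∈-map-≗ e∈z₁
          (u≗ ⨾ ⊕-cong f z₂≗ ⨾ ⊕-cancel (I x) f ⨾ ⊕*-solve (e ∷ []) z₁≗)))
        ... | there g∈hs = Anyₚ.++⁺ʳ (closedNb z₁) (there (∈-map-≗ g∈hs u≗))

      -- I x ⊕ e ⊕ f neighbours the corner z already, so p = e is dropped.
      one-labelled : e ∈ labels x → f ∉ labels x → SideCover x e f
      one-labelled e∈ f∉
        with z , z≗ ← label⇒nb e∈ with ps , p , len ← labels-split e∈ =
        closedNb z ++ map (λ p → I x ⊕ p ⊕ f) ps , ℕ.≤-reflexive length≡ ,
        λ { (inj₁ s) → Anyₚ.++⁺ˡ (Side-closedNb z≗ s)
          ; (inj₂ s) → side₂ (Side-unlabelled f∉ s) }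
        where
        length≡ : length (closedNb z ++ map (λ p → I x ⊕ p ⊕ f) ps) ≡ m + m
        length≡ = trans (length-++ (closedNb z)) (trans
          (cong₂ _+_ (cong suc (length-map-labels (I z ⊕_))) (length-map _ ps))
          (trans (sym (ℕ.+-suc m _)) (cong (m +_) len)))
        side₂ : ∀ {u} → (∃ λ p → p ∈ labels x × I u ≗ I x ⊕ p ⊕ f) →
                Any (I u ≗_) (closedNb z ++ map (λ p → I x ⊕ p ⊕ f) ps)
        side₂ (_ , q∈ , u≗) with ∈-resp-↭ p q∈
        ... | here refl  = Anyₚ.++⁺ˡ (Side-closedNb z≗ (first f e∈ u≗))
        ... | there q∈ps = Anyₚ.++⁺ʳ (closedNb z) (∈-map-≗ q∈ps u≗)

    -- With neither corner a vertex, each side consists of at most `m` points, one for each first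
    -- flip.
    none-labelled : ∀ {x e f} → e ∉ labels x → f ∉ labels x → SideCover x e f
    none-labelled {x} {e} {f} e∉ f∉ =
      map (λ p → I x ⊕ p ⊕ e) (labels x) ++ map (λ p → I x ⊕ p ⊕ f) (labels x) ,
      ℕ.≤-reflexive (trans (length-++ (map _ (labels x)))
        (cong₂ _+_ (length-map-labels (λ p → I x ⊕ p ⊕ e)) (length-map-labels (λ p → I x ⊕ p ⊕ f)))) ,
      λ { (inj₁ s) → let _ , p∈ , u≗ = Side-unlabelled e∉ s in Anyₚ.++⁺ˡ (∈-map-≗ p∈ u≗)
        ; (inj₂ s) → let _ , p∈ , u≗ = Side-unlabelled f∉ s in
            Anyₚ.++⁺ʳ (map (λ p → I x ⊕ p ⊕ e) (labels x)) (∈-map-≗ p∈ u≗) }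

    sideCover : ∀ {x y e f} → e ≢ f → I y ≗ I x ⊕ e ⊕ f → SideCover x e f
    sideCover {x} {e = e} {f} e≢f y≗ with e ∈? labels x | f ∈? labels x
    ... | yes e∈ | yes f∈ = both-labelled e≢f y≗ e∈ f∈
    ... | yes e∈ | no  f∉ = one-labelled e≢f y≗ e∈ f∉
    ... | no  e∉ | yes f∈ = SideCover-swap
      (one-labelled (e≢f ∘ sym) (y≗ ⨾ ⊕-comm (I x) e f) f∈ e∉)
    ... | no  e∉ | no  f∉ = none-labelled e∉ f∉

    -- Vertices differing in four coordinates

    length-reach : ∀ k x → length (reach k x) ≡ m ^ k
    length-reach zero    x = refl
    length-reach (suc k) x = trans (length-concatMap (tabulate (nb x)))
      (cong (_* m ^ k) (length-tabulate (nb x)))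
      where
      length-concatMap : ∀ ys → length (concatMap (reach k) ys) ≡ length ys * m ^ k
      length-concatMap []       = refl
      length-concatMap (y ∷ ys) = trans (length-++ (reach k y))
        (cong₂ _+_ (length-reach k y) (length-concatMap ys))

    Short : V → V → Set
    Short x u = ∃ λ es → length es ≤ 1 × I u ≗ I x ⊕* es

    Long : V → V → Set
    Long x u = Walk Γ x u 2 × ∃₂ λ p q → I u ≗ I x ⊕ p ⊕ q

    short-or-long : ∀ {x u} → Ball Γ 2 x u → Short x u ⊎ Long x u
    short-or-long b with view b
    ... | inj₁ (none u≗)             = inj₁ ([] , z≤n , u≗)
    ... | inj₂ (one e _ u≗)          = inj₁ (e ∷ [] , ℕ.≤-refl , u≗)
    ... | inj₁ (two p q walk w≗ u≗) = inj₂ (walk , p , q , (u≗ ⨾ ⊕-cong q w≗))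

    path : ∀ {x u} → Ball Γ 2 x u → ∃ λ es → length es ≤ 2 × I u ≗ I x ⊕* es
    path b with short-or-long b
    ... | inj₁ (es , len , u≗)  = es , ℕ.≤-trans len (s≤s z≤n) , u≗
    ... | inj₂ (_ , p , q , u≗) = q ∷ p ∷ [] , ℕ.≤-refl , u≗

    -- The flips between `y` and `u` undo themselves, so both lists together lead from `x` by way of
    -- `u` to `y`.
    join : ∀ {x y u es} fs → I u ≗ I x ⊕* es → I u ≗ I y ⊕* fs → I y ≗ I x ⊕* (fs ++ es)
    join {x} {es = es} fs u≗x u≗y c = trans (⊕*-solve fs u≗y c)
      (trans (⊕*-cong fs u≗x c) (cong (λ v → v c) (sym (foldr-++ _ (I x) fs es))))

    length-++≤ : ∀ (es : List E) {fs j k} → length es ≤ j → length fs ≤ k → length (es ++ fs) ≤ j + k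
    length-++≤ es p q = ℕ.≤-trans (ℕ.≤-reflexive (length-++ es)) (ℕ.+-mono-≤ p q)

    module _ {x y fs} (fs! : Unique fs) (length≡4 : length fs ≡ 4) (y≗ : I y ≗ I x ⊕* fs) where

      private
        4≰3 : length fs ≤ 3 → ∀ {A : Set} → A
        4≰3 len = contradiction (subst (_≤ 3) length≡4 len) λ { (s≤s (s≤s (s≤s ()))) }

        too-short : ∀ gs → length gs ≤ 3 → I y ≗ I x ⊕* gs → ∀ {A : Set} → A
        too-short gs len y≗′ = 4≰3 (ℕ.≤-trans (length-minimal (I x) {fs = gs} fs! (≗-sym y≗ ⨾ y≗′)) len)

        -- If `g` were not in `fs`, all four coordinates of `fs` would lie among the at most three
        -- entries of `hs`.
        needed : ∀ {gs g hs} → I y ≗ I x ⊕* gs → gs ↭ g ∷ hs → length hs ≤ 3 → g ∈ fs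
        needed {gs} {g} {hs} y≗′ gs↭ len with g ∈? fs
        ... | yes g∈ = g∈
        ... | no  g∉ = 4≰3 (ℕ.≤-trans (Unique-⊆⇒length≤ fs! fs⊆hs) len)
          where
          fs⊆hs : ∀ {c} → c ∈ fs → c ∈ hs
          fs⊆hs c∈ with ∈-resp-↭ gs↭ (⊕*-⊆ (I x) {fs = gs} fs! (≗-sym y≗ ⨾ y≗′) c∈)
          ... | here refl = contradiction c∈ g∉
          ... | there c∈′ = c∈′

      -- If `u` were at most one flip from either end, three flips would join `x` to `y`. So two
      -- flips are used on each side, all four are coordinates of `fs`, and `p ≡ q` would let two of
      -- them cancel.
      four-view : ∀ {u} → (Ball Γ 2 x ∩ Ball Γ 2 y) u →
                  Walk Γ x u 2 × ∃₂ λ p q → p ∈ fs × q ∈ fs × p ≢ q × I u ≗ I x ⊕ p ⊕ q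
      four-view (b , b′) with short-or-long b | short-or-long b′
      ... | inj₁ (es , len , u≗) | _ with gs , len′ , u≗′ ← path b′ =
        too-short (gs ++ es) (length-++≤ gs len′ len) (join gs u≗ u≗′)
      four-view (b , b′) | inj₂ (_ , p , q , u≗) | inj₁ (gs , len , u≗′) =
        too-short (gs ++ q ∷ p ∷ []) (length-++≤ gs {j = 1} len ℕ.≤-refl) (join gs u≗ u≗′)
      four-view (b , b′) | inj₂ (walk , p , q , u≗) | inj₂ (_ , r , s , u≗′) =
        walk , p , q
        , needed y≗′ (shift p (s ∷ r ∷ q ∷ []) []) ℕ.≤-refl
        , needed y≗′ (shift q (s ∷ r ∷ []) (p ∷ [])) ℕ.≤-refl
        , (λ { refl → too-short (s ∷ r ∷ []) (s≤s (s≤s z≤n))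
                 (y≗′ ⨾ ⊕-cong s (⊕-cong r (⊕-cancel (I x) p))) })
        , u≗
        where
        y≗′ : I y ≗ I x ⊕* (s ∷ r ∷ q ∷ p ∷ [])
        y≗′ = join {x = x} {es = q ∷ p ∷ []} (s ∷ r ∷ []) u≗ u≗′

      -- Six bounds the number of 2-subsets of fs, and m * m the number of walks
      -- of length 2 from x; the latter is needed when 2 * m < 6.
      four-bound : ∀ {k} → HasCard vertices (Ball Γ 2 x ∩ Ball Γ 2 y) k → k ≤ m + m
      four-bound card with m ℕ.≤? 2
      ... | yes m≤2 = ℕ.≤-trans
        (card≤vertices card (reach 2 x)
          (λ u∈ → Walk⇒∈reach 2 (proj₁ (four-view u∈))))
        (ℕ.≤-trans (ℕ.≤-reflexive (length-reach 2 x))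
          (ℕ.≤-trans (ℕ.*-monoˡ-≤ (m * 1) m≤2)
            (ℕ.≤-reflexive (cong₂ _+_ (ℕ.*-identityʳ m) (trans (ℕ.+-identityʳ _) (ℕ.*-identityʳ m))))))
      ... | no  m≰2 = ℕ.≤-trans
        (card≤codes card (pairs (I x) fs)
          (λ u∈ → let _ , p , q , p∈ , q∈ , p≢q , u≗ = four-view u∈ in
                   Any.map (u≗ ⨾_) (∈-pairs p∈ q∈ p≢q)))
        (ℕ.≤-trans (ℕ.≤-reflexive (length-pairs fs length≡4)) (ℕ.+-mono-≤ (ℕ.≰⇒> m≰2) (ℕ.≰⇒> m≰2)))
        where
        length-pairs : ∀ gs → length gs ≡ 4 → length (pairs (I x) gs) ≡ 6
        length-pairs (_ ∷ _ ∷ _ ∷ _ ∷ []) _ = refl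

    -- Upper bounds and maxima

    Balls : ℕ → V → V → ℕ → Set
    Balls r x y = HasCard vertices (Ball Γ r x ∩ Ball Γ r y)

    -- Through the common element `u`, `x` and `y` differ in at most four coordinates; equal parity
    -- leaves zero, two or four, and zero would make them equal.
    even-bound₂ : ∀ {x y} → x ≉ y → σ y ≡ σ x → ∀ {u} → (Ball Γ 2 x ∩ Ball Γ 2 y) u →
                  ∀ {k} → Balls 2 x y k → k ≤ m + m
    even-bound₂ {x} {y} x≉y σ≡ (b , b′)
      with es , len , u≗ ← path b | es′ , len′ , u≗′ ← path b′
      with ⊕*-reduce (es′ ++ es) | length-++≤ es′ len′ len | join es′ u≗ u≗′
    ... | fs , fs! , fs≤ , reduced | total≤ | y≗ =
      λ card → cases fs fs! (ℕ.≤-trans fs≤ total≤) (y≗ ⨾ reduced (I x)) card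
      where
      cases : ∀ fs → Unique fs → length fs ≤ 4 → I y ≗ I x ⊕* fs → ∀ {k} → Balls 2 x y k → k ≤ m + m
      cases [] _ _ y≗ _ = contradiction (I-injective (≗-sym y≗)) x≉y
      cases (_ ∷ []) _ _ y≗ _ = clash σ≡ (σ-flip y≗)
      cases (f ∷ e ∷ []) ((f≢e ∷ []) ∷ _) _ y≗ card with vs , len , cover ← sideCover (f≢e ∘ sym) y≗ =
        ℕ.≤-trans (card≤codes card vs
          (λ u∈ → cover (even-cover₂ (f≢e ∘ sym) y≗ u∈))) len
      cases (g ∷ f ∷ e ∷ []) _ _ y≗ _ = clash σ≡ (trans (parity-cong cs y≗)
        (trans (parity-flip (I x ⊕ e ⊕ f) g) (cong not (trans (parity-flip (I x ⊕ e) f)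
          (trans (cong not (parity-flip (I x) e)) (not-involutive (σ x)))))))
      cases (h ∷ g ∷ f ∷ e ∷ []) fs! _ y≗ card = four-bound fs! refl y≗ card
      cases (_ ∷ _ ∷ _ ∷ _ ∷ _ ∷ _) _ (s≤s (s≤s (s≤s (s≤s ())))) _ _

    even-bound₁ : ∀ {x y} → x ≉ y → σ y ≡ σ x → ∀ {u} → (Ball Γ 1 x ∩ Ball Γ 1 y) u →
                  ∀ {k} → Balls 1 x y k → k ≤ 2
    even-bound₁ {x} {y} x≉y σ≡ (b , b′) card with view₁ b | view₁ b′
    ... | inj₁ u≗x | inj₁ u≗y = contradiction (I-injective (≗-sym u≗x ⨾ u≗y)) x≉y
    ... | inj₁ u≗x | inj₂ o   = clash (trans (σ-cong u≗x) (sym σ≡)) (σ-odd o)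
    ... | inj₂ o   | inj₁ u≗y = clash (trans (σ-cong u≗y) σ≡) (σ-odd o)
    ... | inj₂ (one e _ u≗) | inj₂ (one f _ u≗′) =
      card≤codes card _ (even-cover₁ e≢f y≗)
      where
      y≗ : I y ≗ I x ⊕ e ⊕ f
      y≗ = ⊕*-solve (f ∷ []) u≗′ ⨾ ⊕-cong f u≗
      e≢f : e ≢ f
      e≢f refl = x≉y (I-injective (≗-sym (y≗ ⨾ ⊕-cancel (I x) e)))

    -- An empty intersection needs no bound; otherwise a common element gives
    -- a short walk from x to y.
    nonempty-bound : ∀ {P : Pred V 0ℓ} {b} → (∀ {u} → P u → ∀ {k} → HasCard vertices P k → k ≤ b) →
                     ∀ {k} → HasCard vertices P k → k ≤ b
    nonempty-bound bound {zero}  _    = z≤n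
    nonempty-bound bound {suc k} card = bound (proj₂ (Inverse.to card zero)) card

    bound₁ : ∀ {x y} → x ≉ y → ∀ {k} → Balls 1 x y k → k ≤ 2
    bound₁ {x} {y} x≉y card with σ y ≟ᵇ σ x
    ... | yes σ≡ = nonempty-bound (even-bound₁ x≉y σ≡) card
    ... | no  σ≢ = card≤vertices card _ (odd-cover₁ (¬-not σ≢))

    bound₂ : ∀ {x y} → x ≉ y → ∀ {k} → Balls 2 x y k → k ≤ m + m
    bound₂ {x} {y} x≉y card with σ y ≟ᵇ σ x
    ... | yes σ≡ = nonempty-bound (even-bound₂ x≉y σ≡) card
    ... | no  σ≢ = ℕ.≤-trans
      (card≤vertices card _ (odd-cover₂ (¬-not σ≢)))
      (ℕ.≤-reflexive (length-neighbours (¬-not σ≢)))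

    N₁≡2 : ∀ {x y} → Adj x y → N[ Γ , 1 ]≡ 2
    N₁≡2 {x} {y} adj = (x , y , adjacent⇒≉ adj , adjacent-card₁ adj) , λ v w v≉w →
      let k , card = Ball∩-card 1 v w in k , card , bound₁ v≉w card

    N₂≡2m : ∀ {x y} → Adj x y → N[ Γ , 2 ]≡ (m + m)
    N₂≡2m {x} {y} adj = (x , y , adjacent⇒≉ adj , adjacent-card₂ adj) , λ v w v≉w →
      let k , card = Ball∩-card 2 v w in k , card , bound₂ v≉w card

-- The order of values in a permutation

module _ {n : ℕ} where

  -- The increasing pair names the coordinate of two distinct values irrespective of which of them
  -- stands first.
  sorted : Fin n → Fin n → Fin n × Fin n
  sorted a b with a <? b
  ... | yes _ = a , b
  ... | no  _ = b , a

  sorted-< : ∀ {a b} → a < b → sorted a b ≡ (a , b)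
  sorted-< {a} {b} a<b with a <? b
  ... | yes _   = refl
  ... | no  a≮b = contradiction a<b a≮b

  sorted-≮ : ∀ {a b} → ¬ (a < b) → sorted a b ≡ (b , a)
  sorted-≮ {a} {b} a≮b with a <? b
  ... | yes a<b = contradiction a<b a≮b
  ... | no  _   = refl

  sorted-comm : ∀ a b → sorted a b ≡ sorted b a
  sorted-comm a b with <-cmp a b
  ... | tri< a<b _ b≮a = trans (sorted-< a<b) (sym (sorted-≮ b≮a))
  ... | tri≈ _ refl _  = refl
  ... | tri> a≮b _ b<a = trans (sorted-≮ a≮b) (sym (sorted-< b<a))

  sorted-cases : ∀ {a b c d} → sorted a b ≡ sorted c d → (a ≡ c × b ≡ d) ⊎ (a ≡ d × b ≡ c)
  sorted-cases {a} {b} {c} {d} eq with a <? b | c <? d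
  ... | yes _ | yes _ = inj₁ (,-injectiveˡ eq , ,-injectiveʳ eq)
  ... | yes _ | no  _ = inj₂ (,-injectiveˡ eq , ,-injectiveʳ eq)
  ... | no  _ | yes _ = inj₂ (,-injectiveʳ eq , ,-injectiveˡ eq)
  ... | no  _ | no  _ = inj₁ (,-injectiveʳ eq , ,-injectiveˡ eq)

  -- Induction on `i`: strict increase raises the value of `f` by at least one at each step.
  <-monotone⇒≤ : (f : Fin n → Fin n) → (∀ {i j} → i < j → f i < f j) → ∀ i → toℕ i ≤ toℕ (f i)
  <-monotone⇒≤ f mono i = go (toℕ i) i refl
    where
    go : ∀ k i → toℕ i ≡ k → k ≤ toℕ (f i)
    go zero    i _  = z≤n
    go (suc k) i eq = ℕ.≤-<-trans (go k (fromℕ< k<n) (toℕ-fromℕ< k<n))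
      (mono (subst₂ ℕ._<_ (sym (toℕ-fromℕ< k<n)) (sym eq) ℕ.≤-refl))
      where
      k<n : k ℕ.< n
      k<n = ℕ.<-trans (subst (k ℕ.<_) (sym eq) ℕ.≤-refl) (toℕ<n i)

  _≟₂_ : DecidableEquality (Fin n × Fin n)
  _≟₂_ = ≡-dec _≟_ _≟_

  open Cube _≟₂_

  Perm : Set
  Perm = Permutation′ n

  -- A permutation sends positions to values, so `x ⟨$⟩ˡ a` is the position of the value `a`.
  Before : Perm → Fin n → Fin n → Set
  Before x a b = x ⟨$⟩ˡ a < x ⟨$⟩ˡ b

  -- The coordinates (a , b) with a ≮ b are constantly false, so only one of
  -- (a , b) and (b , a) can be flipped.
  order : Perm → Fin n × Fin n → Bool
  order x (a , b) = does (a <? b) ∧ does (x ⟨$⟩ˡ a <? x ⟨$⟩ˡ b)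

  ⟨$⟩ˡ-injective : ∀ (x : Perm) {a b} → x ⟨$⟩ˡ a ≡ x ⟨$⟩ˡ b → a ≡ b
  ⟨$⟩ˡ-injective x eq = trans (sym (inverseʳ x)) (trans (cong (x ⟨$⟩ʳ_) eq) (inverseʳ x))

  ⟨$⟩ʳ-injective : ∀ (x : Perm) {a b} → x ⟨$⟩ʳ a ≡ x ⟨$⟩ʳ b → a ≡ b
  ⟨$⟩ʳ-injective x eq = trans (sym (inverseˡ x)) (trans (cong (x ⟨$⟩ˡ_) eq) (inverseˡ x))

  Before⇒≢ : ∀ x {a b} → Before x a b → a ≢ b
  Before⇒≢ x r refl = <-irrefl refl r

  Before-total : ∀ x {a b} → a ≢ b → Before x a b ⊎ Before x b a
  Before-total x {a} {b} a≢b with <-cmp (x ⟨$⟩ˡ a) (x ⟨$⟩ˡ b)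
  ... | tri< r _ _  = inj₁ r
  ... | tri≈ _ eq _ = contradiction (⟨$⟩ˡ-injective x eq) a≢b
  ... | tri> _ _ r  = inj₂ r

  -- For `a < b` the coordinate `(a , b)` is true; otherwise the coordinate is `(b , a)`, which is
  -- false because `a` stands first.
  order-sorted : ∀ x {a b} → Before x a b → order x (sorted a b) ≡ does (a <? b)
  order-sorted x {a} {b} r with <-cmp a b
  ... | tri< a<b _ _   = trans (cong (order x) (sorted-< a<b))
    (trans (cong (does (a <? b) ∧_) (dec-true (x ⟨$⟩ˡ a <? x ⟨$⟩ˡ b) r)) (∧-identityʳ _))
  ... | tri≈ _ a≡b _   = contradiction a≡b (Before⇒≢ x r)
  ... | tri> a≮b _ _   = trans (cong (order x) (sorted-≮ a≮b))
    (trans (cong (does (b <? a) ∧_) (dec-false (x ⟨$⟩ˡ b <? x ⟨$⟩ˡ a) (<-asym r)))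
    (trans (∧-zeroʳ _) (sym (dec-false (a <? b) a≮b))))

  does-<?-flip : ∀ {a b : Fin n} → a ≢ b → does (b <? a) ≡ not (does (a <? b))
  does-<?-flip {a} {b} a≢b with <-cmp a b
  ... | tri< a<b _ b≮a = trans (dec-false (b <? a) b≮a) (cong not (sym (dec-true (a <? b) a<b)))
  ... | tri≈ _ eq _    = contradiction eq a≢b
  ... | tri> a≮b _ b<a = trans (dec-true (b <? a) b<a) (cong not (sym (dec-false (a <? b) a≮b)))

  order-sorted⁻¹ : ∀ x {a b} → a ≢ b → order x (sorted a b) ≡ does (a <? b) → Before x a b
  order-sorted⁻¹ x {a} {b} a≢b eq with Before-total x a≢b
  ... | inj₁ r = r
  ... | inj₂ r = contradiction (trans (sym (does-<?-flip a≢b))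
    (trans (sym (order-sorted x r)) (trans (cong (order x) (sorted-comm b a)) eq))) (not-≢ _)
    where
    not-≢ : ∀ b → not b ≢ b
    not-≢ true  ()
    not-≢ false ()

  order-transfer : ∀ {x y} → order x ≗ order y → ∀ {a b} → Before x a b → Before y a b
  order-transfer {x} {y} eq {a} {b} r = order-sorted⁻¹ y (Before⇒≢ x r)
    (trans (sym (eq (sorted a b))) (order-sorted x r))

  order-≮ : ∀ x {a b} → ¬ (a < b) → order x (a , b) ≡ false
  order-≮ x {a} {b} a≮b = cong (_∧ does (x ⟨$⟩ˡ a <? x ⟨$⟩ˡ b)) (dec-false (a <? b) a≮b)

  -- The map `f` from positions in `x` to positions in `y` and its inverse are both strictly
  -- increasing. Neither lowers any position, so `f` is the identity.
  order-injective : ∀ {x y} → order x ≗ order y → x ≈ₚ y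
  order-injective {x} {y} eq i = trans (sym (inverseʳ y)) (cong (y ⟨$⟩ʳ_)
    (toℕ-injective (ℕ.≤-antisym f≤ (<-monotone⇒≤ f (mono {x} {y} eq) i))))
    where
    f : Fin n → Fin n
    f j = y ⟨$⟩ˡ (x ⟨$⟩ʳ j)
    mono : ∀ {x y} → order x ≗ order y → ∀ {i j} → i < j → y ⟨$⟩ˡ (x ⟨$⟩ʳ i) < y ⟨$⟩ˡ (x ⟨$⟩ʳ j)
    mono {x} {y} eq i<j = order-transfer {x} {y} eq (subst₂ _<_ (sym (inverseˡ x)) (sym (inverseˡ x)) i<j)
    f≤ : toℕ (f i) ≤ toℕ i
    -- The inverse of `f` is applied at `f i`, where its value is `i`.
    f≤ = subst (λ k → toℕ (f i) ≤ toℕ k) (trans (cong (x ⟨$⟩ˡ_) (inverseʳ y)) (inverseˡ x))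
      (<-monotone⇒≤ (λ j → x ⟨$⟩ˡ (y ⟨$⟩ʳ j)) (mono {y} {x} (sym ∘ eq)) (f i))

  -- `p` and `q` are the only two values whose relative order changes. Unlike a flipped coordinate,
  -- the record remembers which of them stands first in `x`.
  record Swaps (x y : Perm) (p q : Fin n) : Set where
    field
      beforeˡ : Before x p q
      beforeʳ : Before y q p
      others  : ∀ {c d} → Before x c d → ¬ (c ≡ p × d ≡ q) → Before y c d

    p≢q : p ≢ q
    p≢q = Before⇒≢ x beforeˡ

  module _ {x y p q} (swaps : Swaps x y p q) where
    open Swaps swaps

    private
      at-sorted′ : ∀ {c d} → Before x c d → Dec (sorted p q ≡ sorted c d) →
                   order y (sorted c d) ≡ (order x ⊕ sorted p q) (sorted c d)
      at-sorted′ r (no pq≢cd) = trans (order-sorted y (others r λ { (refl , refl) → pq≢cd refl }))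
        (trans (sym (order-sorted x r)) (sym (⊕-off (order x) pq≢cd)))
      at-sorted′ r (yes pq≡cd) with sorted-cases pq≡cd
      ... | inj₂ (refl , refl) = contradiction r (<-asym beforeˡ)
      ... | inj₁ (refl , refl) = trans (cong (order y) (sorted-comm p q))
        (trans (order-sorted y beforeʳ)
        (trans (does-<?-flip p≢q)
        (trans (cong not (sym (order-sorted x beforeˡ))) (sym (⊕-on (order x) (sorted p q))))))

      at-sorted : ∀ {c d} → Before x c d → order y (sorted c d) ≡ (order x ⊕ sorted p q) (sorted c d)
      at-sorted {c} {d} r = at-sorted′ r (sorted p q ≟₂ sorted c d)

      sorted-increasing : ∀ {c d} → sorted p q ≡ (c , d) → c < d
      sorted-increasing eq with <-cmp p q
      sorted-increasing eq | tri< p<q _ _ with refl ← trans (sym eq) (sorted-< p<q) = p<q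
      sorted-increasing eq | tri≈ _ p≡q _ = contradiction p≡q p≢q
      sorted-increasing eq | tri> p≮q _ q<p with refl ← trans (sym eq) (sorted-≮ p≮q) = q<p

      constant : ∀ {c d} → ¬ (c < d) → order y (c , d) ≡ (order x ⊕ sorted p q) (c , d)
      constant c≮d = trans (order-≮ y c≮d) (trans (sym (order-≮ x c≮d))
        (sym (⊕-off (order x) (c≮d ∘ sorted-increasing))))

    -- An increasing coordinate is `sorted` of its two values taken as they stand in `x`, where the
    -- hypotheses apply. The other coordinates are constantly false and differ from `sorted p q`.
    Swaps⇒order : order y ≗ order x ⊕ sorted p q
    Swaps⇒order (c , d) with <-cmp c d
    ... | tri< c<d c≢d _ with Before-total x c≢d
    ...   | inj₁ r = subst (λ e → order y e ≡ (order x ⊕ sorted p q) e) (sorted-< c<d) (at-sorted r)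
    ...   | inj₂ r = subst (λ e → order y e ≡ (order x ⊕ sorted p q) e)
                       (trans (sorted-comm d c) (sorted-< c<d)) (at-sorted r)
    Swaps⇒order (c , d) | tri≈ c≮d _ _ = constant c≮d
    Swaps⇒order (c , d) | tri> c≮d _ _ = constant c≮d

  order⇒Swaps : ∀ {x y p q} → Before x p q → order y ≗ order x ⊕ sorted p q → Swaps x y p q
  order⇒Swaps {x} {y} {p} {q} r eq = record
    { beforeˡ = r
    ; beforeʳ = order-sorted⁻¹ y (p≢q ∘ sym)
        (trans (cong (order y) (sorted-comm q p))
        (trans (eq (sorted p q))
        (trans (⊕-on (order x) (sorted p q))
        (trans (cong not (order-sorted x r)) (sym (does-<?-flip p≢q))))))
    ; others  = λ {c} {d} s cd≢pq → order-sorted⁻¹ y (Before⇒≢ x s)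
        (trans (eq (sorted c d))
        (trans (⊕-off (order x) (apart s cd≢pq ∘ sorted-cases)) (order-sorted x s)))
    }
    where
    p≢q = Before⇒≢ x r
    apart : ∀ {c d} → Before x c d → ¬ (c ≡ p × d ≡ q) → ¬ ((p ≡ c × q ≡ d) ⊎ (p ≡ d × q ≡ c))
    apart _ cd≢pq (inj₁ (refl , refl)) = cd≢pq (refl , refl)
    apart s _     (inj₂ (refl , refl)) = <-asym r s

  unflippable : ∀ {x y a b} → ¬ (a < b) → ¬ (order y ≗ order x ⊕ (a , b))
  unflippable {x} {y} {a} {b} a≮b eq = contradiction
    (trans (sym (order-≮ y a≮b)) (trans (eq (a , b))
      (trans (⊕-on (order x) (a , b)) (cong not (order-≮ x a≮b))))) λ ()

  order-flip⇒Swaps : ∀ {x y e} → order y ≗ order x ⊕ e →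
                     ∃ λ p → ∃ λ q → e ≡ sorted p q × Swaps x y p q
  order-flip⇒Swaps {x} {y} {a , b} eq with <-cmp a b
  ... | tri≈ a≮b _ _ = contradiction eq (unflippable {x} {y} a≮b)
  ... | tri> a≮b _ _ = contradiction eq (unflippable {x} {y} a≮b)
  ... | tri< a<b a≢b _ with Before-total x a≢b
  ...   | inj₁ r = a , b , sym (sorted-< a<b) ,
            order⇒Swaps {x} {y} r (subst (λ e → order y ≗ order x ⊕ e) (sym (sorted-< a<b)) eq)
  ...   | inj₂ r = b , a , ba , order⇒Swaps {x} {y} r (subst (λ e → order y ≗ order x ⊕ e) ba eq)
    where
    ba : (a , b) ≡ sorted b a
    ba = trans (sym (sorted-< a<b)) (sorted-comm a b)

-- Adjacent transpositions as flips of one coordinate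

module _ {m : ℕ} where

  open Cube (_≟₂_ {suc m})
  private
    V = Permutation′ (suc m)

  -- The transposition acts first, so the values at positions `i` and `i + 1` are exchanged.
  neighbour : V → Fin m → V
  neighbour x i = transpose (inject₁ i) (suc i) ∘ₚ x

  label : V → Fin m → Fin (suc m) × Fin (suc m)
  label x i = sorted (x ⟨$⟩ʳ inject₁ i) (x ⟨$⟩ʳ suc i)

  module _ (i : Fin m) where

    private
      -- This is the inverse of `transpose (inject₁ i) (suc i)`, hence the order of the arguments;
      -- it takes positions in `x` to positions in `neighbour x i`.
      swap : Fin (suc m) → Fin (suc m)
      swap = PC.transpose (suc i) (inject₁ i)

      inject₁<suc : inject₁ i < suc i
      inject₁<suc = s≤s (ℕ.≤-reflexive (toℕ-inject₁ i))

      inject₁≢suc : inject₁ i ≢ suc i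
      inject₁≢suc eq = <-irrefl eq inject₁<suc

      swap-suc : swap (suc i) ≡ inject₁ i
      swap-suc rewrite dec-true (suc i ≟ suc i) refl = refl

      swap-inject₁ : swap (inject₁ i) ≡ suc i
      swap-inject₁ rewrite dec-false (inject₁ i ≟ suc i) inject₁≢suc
                         | dec-true (inject₁ i ≟ inject₁ i) refl = refl

      swap-other : ∀ {k} → k ≢ suc i → k ≢ inject₁ i → swap k ≡ k
      swap-other {k} k≢s k≢i rewrite dec-false (k ≟ suc i) k≢s | dec-false (k ≟ inject₁ i) k≢i = refl

      data Position (k : Fin (suc m)) : Set where
        at-inject₁ : k ≡ inject₁ i → swap k ≡ suc i → Position k
        at-suc     : k ≡ suc i → swap k ≡ inject₁ i → Position k
        elsewhere  : k ≢ inject₁ i → k ≢ suc i → swap k ≡ k → Position k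

      position : ∀ k → Position k
      position k with k ≟ inject₁ i | k ≟ suc i
      ... | yes refl | _        = at-inject₁ refl swap-inject₁
      ... | no _     | yes refl = at-suc refl swap-suc
      ... | no k≢i   | no k≢s   = elsewhere k≢i k≢s (swap-other k≢s k≢i)

      -- No position lies strictly between the two exchanged ones.
      above : ∀ {k} → inject₁ i < k → k ≢ suc i → suc i < k
      above {k} i<k k≢s = ℕ.≤∧≢⇒< (subst (ℕ._< toℕ k) (toℕ-inject₁ i) i<k) (k≢s ∘ sym ∘ toℕ-injective)

      below : ∀ {k} → k < suc i → k ≢ inject₁ i → k < inject₁ i
      below {k} k<s k≢i = ℕ.≤∧≢⇒< (subst (toℕ k ≤_) (sym (toℕ-inject₁ i)) (ℕ.s≤s⁻¹ k<s)) (k≢i ∘ toℕ-injective)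

      -- The exchanged positions are consecutive, so every other position lies on the same side of
      -- both.
      swap-mono : ∀ {k l} → k < l → ¬ (k ≡ inject₁ i × l ≡ suc i) → swap k < swap l
      swap-mono {k} {l} k<l ¬both with position k | position l
      ... | at-inject₁ refl _ | at-inject₁ refl _ = contradiction k<l (<-irrefl refl)
      ... | at-inject₁ refl _ | at-suc refl _     = contradiction (refl , refl) ¬both
      ... | at-inject₁ refl p | elsewhere _ l≢s q = subst₂ _<_ (sym p) (sym q) (above k<l l≢s)
      ... | at-suc refl _     | at-inject₁ refl _ = contradiction inject₁<suc (<-asym k<l)
      ... | at-suc refl _     | at-suc refl _     = contradiction k<l (<-irrefl refl)
      ... | at-suc refl p     | elsewhere _ _ q   = subst₂ _<_ (sym p) (sym q) (<-trans inject₁<suc k<l)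
      ... | elsewhere _ _ p   | at-inject₁ refl q = subst₂ _<_ (sym p) (sym q) (<-trans k<l inject₁<suc)
      ... | elsewhere k≢i _ p | at-suc refl q     = subst₂ _<_ (sym p) (sym q) (below k<l k≢i)
      ... | elsewhere _ _ p   | elsewhere _ _ q   = subst₂ _<_ (sym p) (sym q) k<l

    neighbour-swaps : ∀ x → Swaps x (neighbour x i) (x ⟨$⟩ʳ inject₁ i) (x ⟨$⟩ʳ suc i)
    neighbour-swaps x = record
      { beforeˡ = subst₂ _<_ (sym (inverseˡ x)) (sym (inverseˡ x)) inject₁<suc
      ; beforeʳ = subst₂ _<_
          (sym (trans (cong swap (inverseˡ x)) swap-suc))
          (sym (trans (cong swap (inverseˡ x)) swap-inject₁)) inject₁<suc
      ; others  = λ r ¬pq → swap-mono r λ (c≡ , d≡) → ¬pq (move c≡ , move d≡)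
      }
      where
      move : ∀ {c k} → x ⟨$⟩ˡ c ≡ k → c ≡ x ⟨$⟩ʳ k
      move eq = trans (sym (inverseʳ x)) (cong (x ⟨$⟩ʳ_) eq)

  order-neighbour : ∀ x i → order (neighbour x i) ≗ order x ⊕ label x i
  order-neighbour x i = Swaps⇒order (neighbour-swaps i x)

  -- Equal labels come from the same two positions. A crosswise match would give `i = j + 1` and
  -- `j = i + 1`, hence `i = i + 2`.
  label-injective : ∀ x {i j} → label x i ≡ label x j → i ≡ j
  label-injective x {i} {j} eq with sorted-cases eq
  ... | inj₁ (p , _) = inject₁-injective (⟨$⟩ʳ-injective x p)
  ... | inj₂ (p , q) = contradiction
    (trans (trans (sym (toℕ-inject₁ i)) (cong toℕ (⟨$⟩ʳ-injective x p)))
      (cong suc (trans (sym (toℕ-inject₁ j)) (cong toℕ (sym (⟨$⟩ʳ-injective x q))))))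
    (ℕ.m≢1+n+m (toℕ i) {1})

  -- A value placed between p and q would have to lie both after p and before q
  -- once p and q have changed places.
  Swaps⇒consecutive : ∀ {x y p q} → Swaps x y p q → toℕ (x ⟨$⟩ˡ q) ≡ suc (toℕ (x ⟨$⟩ˡ p))
  Swaps⇒consecutive {x} {y} {p} {q} swaps with ℕ.m≤n⇒m<n∨m≡n (Swaps.beforeˡ swaps)
  ... | inj₂ eq  = sym eq
  ... | inj₁ gap = contradiction (<-trans y-pc y-cq) (<-asym beforeʳ)
    where
    open Swaps swaps
    bound : suc (toℕ (x ⟨$⟩ˡ p)) ℕ.< suc m
    bound = ℕ.<-trans gap (toℕ<n _)
    c : Fin (suc m)
    c = x ⟨$⟩ʳ fromℕ< bound
    pos-c : toℕ (x ⟨$⟩ˡ c) ≡ suc (toℕ (x ⟨$⟩ˡ p))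
    pos-c = trans (cong toℕ (inverseˡ x)) (toℕ-fromℕ< bound)
    x-pc : Before x p c
    x-pc = ℕ.≤-reflexive (sym pos-c)
    x-cq : Before x c q
    x-cq = subst (ℕ._< toℕ (x ⟨$⟩ˡ q)) (sym pos-c) gap
    y-pc : Before y p c
    y-pc = others x-pc λ (_ , c≡q) → Before⇒≢ x x-cq c≡q
    y-cq : Before y c q
    y-cq = others x-cq λ (c≡p , _) → Before⇒≢ x x-pc (sym c≡p)

  consecutive : ∀ {k l : Fin (suc m)} → toℕ l ≡ suc (toℕ k) → ∃ λ i → k ≡ inject₁ i × l ≡ suc i
  consecutive {l = suc i} eq =
    i , toℕ-injective (trans (sym (ℕ.suc-injective eq)) (sym (toℕ-inject₁ i))) , refl

  -- The flip exchanges two values consecutive in `x`, so it carries the label of some `i`; then `y`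
  -- and `neighbour x i` have the same order and coincide.
  order-flip⇒neighbour : ∀ {x y e} → order y ≗ order x ⊕ e → ∃ λ i → y ≈ₚ neighbour x i
  order-flip⇒neighbour {x} {y} {e} eq
    with p , q , refl , swaps ← order-flip⇒Swaps {x = x} {y} {e} eq
    with i , p≡ , q≡ ← consecutive (Swaps⇒consecutive swaps) =
    i , order-injective {x = y} {neighbour x i} λ c → trans (eq c)
      (trans (cong₂ (λ a b → (order x ⊕ sorted a b) c) (move p≡) (move q≡)) (sym (order-neighbour x i c)))
    where
    move : ∀ {c k} → x ⟨$⟩ˡ c ≡ k → c ≡ x ⟨$⟩ʳ k
    move eq = trans (sym (inverseʳ x)) (cong (x ⟨$⟩ʳ_) eq)

  open SimpleGraph (bubbleSortGraph (suc m)) using (Adj)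

  neighbour-adjacent : ∀ x i → Adj x (neighbour x i)
  neighbour-adjacent x i = transpose (inject₁ i) (suc i)
    , (inject₁ i , suc i , cong suc (sym (toℕ-inject₁ i)) , λ _ → refl) , λ _ → refl

  adjacent⇒neighbour : ∀ {x y} → Adj x y → ∃ λ i → y ≈ₚ neighbour x i
  adjacent⇒neighbour {x} (_ , (_ , _ , j≡1+i , s≈) , y≈xs) with k , refl , refl ← consecutive j≡1+i =
    k , λ l → trans (y≈xs l) (cong (x ⟨$⟩ʳ_) (s≈ l))

  order-flip⇒adjacent : ∀ {x y e} → order y ≗ order x ⊕ e → Adj x y
  order-flip⇒adjacent {x} {y} {e} eq
    with i , y≈ ← order-flip⇒neighbour {x} {y} {e} eq
    with s , s∈T , nb≈ ← neighbour-adjacent x i = s , s∈T , λ k → trans (y≈ k) (nb≈ k)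

  _≈ₚ?_ : Decidable {A = V} _≈ₚ_
  x ≈ₚ? y = all? λ i → x ⟨$⟩ʳ i ≟ y ⟨$⟩ʳ i

  order-cong : ∀ {x y : V} → x ≈ₚ y → order x ≗ order y
  order-cong {x} {y} x≈y (a , b) =
    cong₂ (λ k l → does (a <? b) ∧ does (k <? l)) (inverse-cong a) (inverse-cong b)
    where
    inverse-cong : ∀ a → x ⟨$⟩ˡ a ≡ y ⟨$⟩ˡ a
    inverse-cong = Group.⁻¹-cong (Sym (suc m)) {x} {y} x≈y

  open InducedCube (bubbleSortGraph (suc m))
    _≟₂_ _≈ₚ?_
    (cartesianProduct (allFin (suc m)) (allFin (suc m)))
    (cartesianProduct⁺ (allFin⁺ (suc m)) (allFin⁺ (suc m)))
    (λ (a , b) → ∈-cartesianProduct⁺ (∈-allFin a) (∈-allFin b))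
    order
    (λ {x} {y} → order-cong {x} {y})
    (λ {x} {y} → order-injective {x = x} {y})
    (λ {x} {y} {e} → order-flip⇒adjacent {x} {y} {e})
    m neighbour label label-injective order-neighbour
    (λ {x} {y} → adjacent⇒neighbour {x} {y})
    public
    using (N₁≡2; N₂≡2m)

theorem6 : (n : ℕ) → 3 ≤ n →
    (N[ bubbleSortGraph n , 1 ]≡ 2) × (N[ bubbleSortGraph n , 2 ]≡ (2 * (n ∸ 1)))
theorem6 (suc zero) (s≤s ())
theorem6 (suc (suc m)) _ =
  N₁≡2 {x = idₚ} {neighbour idₚ zero} adj ,
  -- Here `n - 1` is `suc m`, and `2 * suc m` unfolds to `suc m + (suc m + 0)`.
  subst (N[ bubbleSortGraph (suc (suc m)) , 2 ]≡_) (cong (suc m +_) (sym (ℕ.+-identityʳ (suc m))))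
    (N₂≡2m {x = idₚ} {neighbour idₚ zero} adj)
  where
  adj = neighbour-adjacent idₚ zero
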